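{- Let $n\ge 3$ and consider the affine Weyl group $W_{\mathrm{aff}}$ of type $A_{n-1}^{(1)}$. Let $\alpha\in\Pi_{\mathrm{aff}}^{\mathrm{re},+}$ be such that $\alpha<c$. Then $\Gamma_\alpha(id)=\{s_\alpha\}$.
   Context: Roots. Let $n\ge 3$. Let $\alpha_0,\dots,\alpha_{n-1}$ (indices mod $n$) be the affine simple roots of type $A_{n-1}^{(1)}$, $Q_{\mathrm{aff}}=\bigoplus_{i=0}^{n-1}\mathbb Z\alpha_i$, with symmetric form $\langle\alpha_i,\alpha_i\rangle=2$, $\langle\alpha_i,\alpha_{i\pm1}\rangle=-1$, all other $\langle\alpha_i,\alpha_j\rangle=0$. For $a,b\in Q_{\mathrm{aff}}$, $a\le b$ means $b-a$ has non-negative coefficients, and $a<b$ means $a\le b$, $a\ne b$. Put $c=\sum_{i=0}^{n-1}\alpha_i$ (identified with the imaginary root $\delta$). Let $\Pi=\Pi^+\sqcup\Pi^-$ be the finite root system of type $A_{n-1}$ with simple roots $\alpha_1,\dots,\alpha_{n-1}$. The affine real roots are $\alpha+mc$ with $\alpha\in\Pi$, $m\in\mathbb Z$; such a root is positive if $m>0$, or $m=0$ and $\alpha\in\Pi^+$. The set of positive real roots is $\Pi_{\mathrm{aff}}^{\mathrm{re},+}$. Weyl group. For a real root $\alpha$, $s_\alpha(\mu)=\mu-\langle\mu,\alpha\rangle\alpha$. $W_{\mathrm{aff}}$ is the group generated by $s_i=s_{\alpha_i}$, $0\le i\le n-1$ (a Coxeter group with these generators), with length $\ell$ and Bruhat order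 $\le$. Curve neighborhoods. The moment graph has vertex set $W_{\mathrm{aff}}$ and an edge $u\stackrel{\alpha}{\longrightarrow}us_\alpha$ of degree $\alpha$ for each $u\in W_{\mathrm{aff}}$, $\alpha\in\Pi_{\mathrm{aff}}^{\mathrm{re},+}$. The degree of a chain (a succession of adjacent edges, possibly empty) is the sum of the degrees of its edges. A degree is a tuple $\mathbf d=(d_0,\dots,d_{n-1})\in\mathbb Z_{\ge0}^n$, identified with $\sum d_i\alpha_i$; degrees are ordered componentwise. For $u\in W_{\mathrm{aff}}$, $\Gamma_{\mathbf d}(u)$ is the set of Bruhat-maximal elements of the set of all $v\in W_{\mathrm{aff}}$ that can be joined to some $u'\le u$ by a chain of degree $\le\mathbf d$. -}

module Defs where

open import Algebra.Properties.Semiring.Sum using (sum)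
open import Data.Bool.Base using (if_then_else_; _∧_; _∨_)
open import Data.Fin.Base as Fin using (Fin; toℕ)
import Data.Fin.Properties as Fin
open import Data.Integer.Base as ℤ using (ℤ; +_; -[1+_]; 0ℤ; 1ℤ)
import Data.Integer.Properties as ℤ
open import Data.List.Base using (List; []; _∷_; _++_; [_]; length; reverse)
open import Data.Nat.Base as ℕ using (ℕ; suc; NonZero)
open import Data.Nat.DivMod using (_mod_)
open import Data.Product.Base using (∃; ∃₂; _×_)
open import Data.Sum.Base using (_⊎_)
open import Data.Vec.Base using (Vec; lookup; tabulate; replicate; zipWith; map)
open import Function.Base using (id; _∘_)
open import Level using (0ℓ)
open import Relation.Binary.PropositionalEquality using (_≡_; _≢_; _≗_)
open import Relation.Nullary.Decidable using (⌊_⌋)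
open import Relation.Unary using (Pred; _∈_)

private
  variable
    n : ℕ

------------------------------------------------------------------------
-- The affine root lattice of type A_{n-1}^{(1)}

-- An element is its vector of coefficients in the basis α₀, …, α_{n-1}.
Q : ℕ → Set
Q n = Vec ℤ n

infixl 6 _⊕_ _⊖_
infixr 7 _·_
infix  4 _≼_ _≺_

_⊕_ : Q n → Q n → Q n
_⊕_ = zipWith ℤ._+_

_⊖_ : Q n → Q n → Q n
_⊖_ = zipWith ℤ._-_

_·_ : ℤ → Q n → Q n
k · a = map (k ℤ.*_) a

neg : Q n → Q n
neg = map (λ x → ℤ.- x)

𝟎 : Q n
𝟎 {n} = replicate n 0ℤ

simpleRoot : Fin n → Q n
simpleRoot i = tabulate λ k → if ⌊ i Fin.≟ k ⌋ then 1ℤ else 0ℤ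

c : Q n
c {n} = replicate n 1ℤ

_≼_ : Q n → Q n → Set
a ≼ b = ∀ i → lookup a i ℤ.≤ lookup b i

_≺_ : Q n → Q n → Set
a ≺ b = a ≼ b × a ≢ b

-- i + 1 modulo n
next : Fin n → Fin n
next {n} i = suc (toℕ i) mod n
  where
  instance
    n≢0 : NonZero n
    n≢0 = Fin.nonZeroIndex i

-- ⟨αᵢ,αⱼ⟩; this is the Cartan matrix of A_{n-1}^{(1)} only when n ≥ 3.
cartan : Fin n → Fin n → ℤ
cartan i j =
  if ⌊ i Fin.≟ j ⌋ then + 2
  else if ⌊ next i Fin.≟ j ⌋ ∨ ⌊ next j Fin.≟ i ⌋ then -[1+ 0 ]
  else 0ℤ

⟨_,_⟩ : Q n → Q n → ℤ
⟨ a , b ⟩ =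
  sum ℤ.+-*-semiring λ i → sum ℤ.+-*-semiring λ j →
    lookup a i ℤ.* lookup b j ℤ.* cartan i j

------------------------------------------------------------------------
-- Real roots

-- αᵢ + αᵢ₊₁ + ⋯ + αⱼ (no wrap-around; meaningful for i ≤ j)
interval : Fin n → Fin n → Q n
interval i j =
  tabulate λ k → if ⌊ i Fin.≤? k ⌋ ∧ ⌊ k Fin.≤? j ⌋ then 1ℤ else 0ℤ

-- The finite root system of type A_{n-1} on α₁, …, α_{n-1}: its positive
-- roots are the αᵢ + ⋯ + αⱼ with 1 ≤ i ≤ j ≤ n - 1.
Π⁺ : Pred (Q n) 0ℓ
Π⁺ β = ∃₂ λ i j → 1 ℕ.≤ toℕ i × i Fin.≤ j × β ≡ interval i j

Π⁻ : Pred (Q n) 0ℓ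
Π⁻ β = neg β ∈ Π⁺

Π : Pred (Q n) 0ℓ
Π β = β ∈ Π⁺ ⊎ β ∈ Π⁻

PositiveRealRoot : Pred (Q n) 0ℓ
PositiveRealRoot γ = ∃₂ λ β m →
  β ∈ Π × γ ≡ β ⊕ m · c × (0ℤ ℤ.< m ⊎ (m ≡ 0ℤ × β ∈ Π⁺))

------------------------------------------------------------------------
-- The affine Weyl group

s : Q n → Q n → Q n
s α μ = μ ⊖ ⟨ μ , α ⟩ · α

⟦_⟧ : List (Fin n) → Q n → Q n
⟦ [] ⟧    = id
⟦ i ∷ w ⟧ = s (simpleRoot i) ∘ ⟦ w ⟧

-- W_aff as a set of transformations of Q n, compared by _≗_.  The
-- generators are involutions, so their products already form a group.
W : Pred (Q n → Q n) 0ℓ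
W u = ∃ λ w → u ≗ ⟦ w ⟧

HasLength : (Q n → Q n) → ℕ → Set
HasLength u k =
  (∃ λ w → u ≗ ⟦ w ⟧ × length w ≡ k) ×
  (∀ w → u ≗ ⟦ w ⟧ → k ℕ.≤ length w)

-- The reflections of the Coxeter group: conjugates w sᵢ w⁻¹.
Reflection : Pred (Q n → Q n) 0ℓ
Reflection t = ∃₂ λ w i → t ≗ ⟦ w ++ [ i ] ++ reverse w ⟧

infix 4 _⟶_ _≤ᴮ_

_⟶_ : (u v : Q n → Q n) → Set
u ⟶ v =
  (∃ λ t → t ∈ Reflection × v ≗ u ∘ t) ×
  (∃₂ λ k l → HasLength u k × HasLength v l × k ℕ.< l)

-- Bruhat order on W: the reflexive transitive closure of _⟶_, with
-- reflexivity taken up to _≗_.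
data _≤ᴮ_ {n} : (u v : Q n → Q n) → Set where
  refl : ∀ {u v} → u ∈ W → u ≗ v → u ≤ᴮ v
  step : ∀ {u v w} → u ⟶ v → v ≤ᴮ w → u ≤ᴮ w

------------------------------------------------------------------------
-- Curve neighbourhoods

Edge : (u : Q n → Q n) (α : Q n) (v : Q n → Q n) → Set
Edge u α v = u ∈ W × α ∈ PositiveRealRoot × v ≗ u ∘ s α

-- Chain u d v: a chain of degree d from u to v.  Since s α is an
-- involution, every edge also occurs in the opposite direction with the same
-- degree, so following directed edges loses nothing.
data Chain {n} : (u : Q n → Q n) (d : Q n) (v : Q n → Q n) → Set where
  []  : ∀ {u v} → u ∈ W → u ≗ v → Chain u 𝟎 v
  _∷_ : ∀ {u v w α d} → Edge u α v → Chain v d w → Chain u (α ⊕ d) w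

-- A degree (d₀, …, d_{n-1}) is given by the lattice element Σ dᵢαᵢ; the
-- definitions make sense for every d : Q n, degrees being those with 𝟎 ≼ d.
Reachable : Q n → (Q n → Q n) → Pred (Q n → Q n) 0ℓ
Reachable d u v = ∃₂ λ u′ e → u′ ≤ᴮ u × Chain u′ e v × e ≼ d

Γ : Q n → (Q n → Q n) → Pred (Q n → Q n) 0ℓ
Γ d u v = v ∈ Reachable d u × (∀ w → w ∈ Reachable d u → v ≤ᴮ w → w ≗ v)

{-# OPTIONS --safe #-}
module Submission where

-- Call a lattice element of norm 2 a root.  The form is positive semidefinite
-- with kernel ℤc and takes even values on the diagonal, so a root has
-- coefficients of one sign, and a word whose action makes N distinct positive
-- roots negative has at least N letters.  The degrees of a chain from id inside
-- α < c are roots with disjoint supports.  Counting inversions, a product of r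
-- reflections in such roots with sum σ has length 2·ht(σ) − r, in any order.
-- Both replacing two factors β, γ with ⟨β,γ⟩ = −1 by their sum and inserting a
-- simple root outside the support raise this length by one and multiply the
-- product by a reflection, so they are steps up in the Bruhat order.  Insert
-- simple roots until the sum is α, then merge until the factors are pairwise
-- orthogonal: the norm of their sum is then 2r and equals ⟨α,α⟩ = 2, so only
-- s_α is left.

open import Defs
open import Data.Bool.Base using (true; false; if_then_else_; _∧_; _∨_)
open import Data.Empty using (⊥-elim)
open import Data.Fin.Base as Fin using (Fin; zero; suc; toℕ; fromℕ; inject₁)
open import Data.Fin.Induction using (<-weakInduction)
import Data.Fin.Properties as Fin
open import Data.Integer.Base as ℤ using (ℤ; +_; -[1+_]; 0ℤ; 1ℤ; -1ℤ; _+_; _*_; -_; _-_)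
import Data.Integer.Properties as ℤ
open import Data.Integer.Tactic.RingSolver using (solve-∀)
open import Data.List.Base as List using (List; []; _∷_; _++_; [_]; length; reverse)
import Data.List.Membership.Propositional as List
open import Data.List.Membership.Propositional.Properties using (∈-map⁻)
import Data.List.Properties as List
open import Data.List.Relation.Binary.Sublist.Propositional using (_⊆_; []; _∷_; _∷ʳ_; ⊆-refl)
open import Data.List.Relation.Binary.Sublist.Propositional.Properties using (All-resp-⊆)
open import Data.List.Relation.Unary.All as All using (All; []; _∷_)
import Data.List.Relation.Unary.All.Properties as All
open import Data.List.Relation.Unary.AllPairs using (AllPairs; []; _∷_)
open import Data.List.Relation.Unary.Unique.Propositional using (Unique)
import Data.List.Relation.Unary.Unique.Propositional.Properties as Unique
open import Data.Nat.Base as ℕ using (ℕ; zero; suc; z≤n; s≤s; _≤_)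
import Data.Nat.DivMod as ℕ
import Data.Nat.Properties as ℕ
open import Data.Product.Base using (∃; _×_; _,_; proj₁; proj₂)
open import Data.Sum.Base using (_⊎_; inj₁; inj₂; [_,_]′)
open import Data.Vec.Base as Vec using (lookup; tabulate)
open import Data.Vec.Properties using (lookup-zipWith; lookup-map; lookup-replicate; lookup∘tabulate)
open import Data.Vec.Properties using (zipWith-assoc; zipWith-comm; zipWith-identityʳ)
open import Function.Base using (id; _∘_)
open import Level using (0ℓ)
open import Relation.Binary.Definitions using (tri<; tri≈; tri>)
open import Relation.Binary.PropositionalEquality hiding ([_])
open import Relation.Nullary using (¬_; yes; no)
open import Relation.Nullary.Decidable using (⌊_⌋; toSum)
open import Relation.Unary using (Pred; _∈_; _≐_)
import Algebra.Properties.AbelianGroup ℤ.+-0-abelianGroup as ℤ-Group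
import Algebra.Properties.Semiring.Sum ℤ.+-*-semiring as Sum
open Sum using (sum)

-- A step `_⟶_` asks for the exact lengths of both its ends, so every element on the way up to s_α
-- must have a known length. This is why the argument stays within products of reflections in roots
-- with disjoint supports, a family closed under both moves. Lengths add in this family because
-- `s γ` changes only the coefficients in the support of γ, while the sign of a root can be read off
-- any of its nonzero coefficients: the factors cannot undo each other's inversions. The condition α
-- < c enters in two ways. Coefficients at most 1 force the supports apart and give each single
-- reflection its length 2·ht - 1. The vertex where α vanishes rules out two factors with sum c,
-- whose pairing is -2: they neither commute nor merge into a root.

private
  variable
    n : ℕ

-- Finite sums of integers

sum-cong : {f g : Fin n → ℤ} → f ≗ g → sum f ≡ sum g
sum-cong = Sum.sum-cong-≗

sum-zero : {f : Fin n → ℤ} → (∀ i → f i ≡ 0ℤ) → sum f ≡ 0ℤ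
sum-zero {n} f≡0 = trans (Sum.sum-cong-≗ f≡0) (Sum.sum-replicate-zero n)

sum-≤0 : (f : Fin n → ℤ) → (∀ i → f i ℤ.≤ 0ℤ) → sum f ℤ.≤ 0ℤ
sum-≤0 {zero}  f f≤0 = ℤ.≤-refl
sum-≤0 {suc n} f f≤0 = ℤ.+-mono-≤ (f≤0 zero) (sum-≤0 (f ∘ suc) (f≤0 ∘ suc))

sum-≥0 : (f : Fin n → ℤ) → (∀ i → 0ℤ ℤ.≤ f i) → 0ℤ ℤ.≤ sum f
sum-≥0 {zero}  f f≥0 = ℤ.≤-refl
sum-≥0 {suc n} f f≥0 = ℤ.+-mono-≤ (f≥0 zero) (sum-≥0 (f ∘ suc) (f≥0 ∘ suc))

+≡0⇒≡0 : ∀ {x y} → 0ℤ ℤ.≤ x → 0ℤ ℤ.≤ y → x + y ≡ 0ℤ → x ≡ 0ℤ × y ≡ 0ℤ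
+≡0⇒≡0 {+ zero} {+ y} p q e = refl , e
+≡0⇒≡0 {+ suc x} {+ y} p q ()

sum-≥0-≡0 : (f : Fin n → ℤ) → (∀ i → 0ℤ ℤ.≤ f i) → sum f ≡ 0ℤ → ∀ i → f i ≡ 0ℤ
sum-≥0-≡0 {suc n} f f≥0 eq with +≡0⇒≡0 (f≥0 zero) (sum-≥0 (f ∘ suc) (f≥0 ∘ suc)) eq
... | f0≡0 , fs≡0 = λ { zero → f0≡0 ; (suc i) → sum-≥0-≡0 (f ∘ suc) (f≥0 ∘ suc) fs≡0 i }

sum-neg : (f : Fin n → ℤ) → sum (λ i → - f i) ≡ - sum f
sum-neg {zero} f = refl
sum-neg {suc n} f = trans (cong (λ z → - f zero + z) (sum-neg (f ∘ suc))) (sym (ℤ.neg-distrib-+ (f zero) _))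

δ : Fin n → Fin n → ℤ
δ i k = if ⌊ i Fin.≟ k ⌋ then 1ℤ else 0ℤ

δ-≡ : {i k : Fin n} → i ≡ k → δ i k ≡ 1ℤ
δ-≡ {i = i} {k} i≡k with i Fin.≟ k
... | yes _   = refl
... | no  i≢k = ⊥-elim (i≢k i≡k)

δ-≢ : {i k : Fin n} → i ≢ k → δ i k ≡ 0ℤ
δ-≢ {i = i} {k} i≢k with i Fin.≟ k
... | yes i≡k = ⊥-elim (i≢k i≡k)
... | no  _   = refl

sum-δ : (i : Fin n) (f : Fin n → ℤ) → sum (λ k → δ i k * f k) ≡ f i
sum-δ zero f = trans (cong₂ _+_ (ℤ.*-identityˡ (f zero)) (sum-zero {f = λ k → δ zero (suc k) * f (suc k)} (λ k → refl)))
  (ℤ.+-identityʳ (f zero))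
sum-δ (suc i) f = trans (ℤ.+-identityˡ _) (trans (sum-cong {g = λ k → δ i k * f (suc k)} lem) (sum-δ i (f ∘ suc)))
  where
  lem : ∀ k → δ (suc i) (suc k) * f (suc k) ≡ δ i k * f (suc k)
  lem k with i Fin.≟ k
  ... | yes _ = refl
  ... | no _ = refl

sum-δ-1 : (i : Fin n) → sum (δ i) ≡ 1ℤ
sum-δ-1 i = trans (sum-cong λ k → sym (ℤ.*-identityʳ (δ i k))) (sum-δ i (λ _ → 1ℤ))

sum-+ : (f g : Fin n → ℤ) → sum (λ i → f i + g i) ≡ sum f + sum g
sum-+ = Sum.∑-distrib-+

sum-* : (k : ℤ) (f : Fin n → ℤ) → sum (λ i → k * f i) ≡ k * sum f
sum-* k f = sym (Sum.*-distribˡ-sum k f)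

-- Coordinates

lookup-inj : {a b : Q n} → lookup a ≗ lookup b → a ≡ b
lookup-inj {a = Vec.[]}    {Vec.[]}    eq = refl
lookup-inj {a = x Vec.∷ a} {y Vec.∷ b} eq = cong₂ Vec._∷_ (eq zero) (lookup-inj (eq ∘ suc))

lookup-⊕ : (a b : Q n) (i : Fin n) → lookup (a ⊕ b) i ≡ lookup a i + lookup b i
lookup-⊕ a b i = lookup-zipWith _+_ i a b

lookup-⊖ : (a b : Q n) (i : Fin n) → lookup (a ⊖ b) i ≡ lookup a i - lookup b i
lookup-⊖ a b i = lookup-zipWith _-_ i a b

lookup-· : (k : ℤ) (a : Q n) (i : Fin n) → lookup (k · a) i ≡ k * lookup a i
lookup-· k a i = lookup-map i (k *_) a

lookup-neg : (a : Q n) (i : Fin n) → lookup (neg a) i ≡ - lookup a i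
lookup-neg a i = lookup-map i (λ x → - x) a

lookup-𝟎 : (i : Fin n) → lookup 𝟎 i ≡ 0ℤ
lookup-𝟎 i = lookup-replicate i 0ℤ

lookup-c : (i : Fin n) → lookup c i ≡ 1ℤ
lookup-c i = lookup-replicate i 1ℤ

lookup-simpleRoot : (i k : Fin n) → lookup (simpleRoot i) k ≡ δ i k
lookup-simpleRoot i k = lookup∘tabulate _ k

-- The bilinear form

-- The shape k·a ⊕ b covers sums (k = 1), differences (k = -1) and reflections (k = -⟨μ,α⟩) by one
-- identity.
⟨⟩-linˡ : (k : ℤ) (a b d : Q n) → ⟨ (k · a) ⊕ b , d ⟩ ≡ k * ⟨ a , d ⟩ + ⟨ b , d ⟩
⟨⟩-linˡ k a b d = begin
  ⟨ (k · a) ⊕ b , d ⟩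
    ≡⟨ sum-cong (λ i → sum-cong (λ j → eq i j)) ⟩
  sum (λ i → sum (λ j → k * A i j + B i j))
    ≡⟨ sum-cong (λ i → trans (sum-+ (λ j → k * A i j) (B i)) (cong (_+ sum (B i)) (sum-* k (A i)))) ⟩
  sum (λ i → k * sum (A i) + sum (B i))
    ≡⟨ trans (sum-+ (λ i → k * sum (A i)) (λ i → sum (B i))) (cong (_+ ⟨ b , d ⟩) (sum-* k (λ i → sum (A i)))) ⟩
  k * ⟨ a , d ⟩ + ⟨ b , d ⟩ ∎
  where
  open ≡-Reasoning
  A B : Fin _ → Fin _ → ℤ
  A i j = lookup a i * lookup d j * cartan i j
  B i j = lookup b i * lookup d j * cartan i j
  ring : ∀ k x y z w → (k * x + y) * z * w ≡ k * (x * z * w) + y * z * w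
  ring = solve-∀
  eq : ∀ i j → lookup ((k · a) ⊕ b) i * lookup d j * cartan i j ≡ k * A i j + B i j
  eq i j rewrite lookup-⊕ (k · a) b i | lookup-· k a i = ring k (lookup a i) (lookup b i) (lookup d j) (cartan i j)

if-∨-swap : ∀ {A : Set} (p q : _) {x y : A} → (if p ∨ q then x else y) ≡ (if q ∨ p then x else y)
if-∨-swap true  true  = refl
if-∨-swap true  false = refl
if-∨-swap false true  = refl
if-∨-swap false false = refl

cartan-sym : (i j : Fin n) → cartan i j ≡ cartan j i
cartan-sym i j with i Fin.≟ j | j Fin.≟ i
... | yes _   | yes _   = refl
... | yes i≡j | no  j≢i = ⊥-elim (j≢i (sym i≡j))
... | no  i≢j | yes j≡i = ⊥-elim (i≢j (sym j≡i))
... | no  _   | no  _   = if-∨-swap ⌊ next i Fin.≟ j ⌋ ⌊ next j Fin.≟ i ⌋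

cartan-≤0 : {i j : Fin n} → i ≢ j → cartan i j ℤ.≤ 0ℤ
cartan-≤0 {i = i} {j} i≢j with i Fin.≟ j
... | yes i≡j = ⊥-elim (i≢j i≡j)
... | no  _ with ⌊ next i Fin.≟ j ⌋ ∨ ⌊ next j Fin.≟ i ⌋
...   | true  = ℤ.-≤+
...   | false = ℤ.≤-refl

⟨⟩-sym : (a b : Q n) → ⟨ a , b ⟩ ≡ ⟨ b , a ⟩
⟨⟩-sym {n} a b = trans (Sum.∑-comm {n} {n} (λ i j → lookup a i * lookup b j * cartan i j))
  (sum-cong λ j → sum-cong λ i → cong₂ _*_ (ℤ.*-comm (lookup a i) (lookup b j)) (cartan-sym i j))

toℕ-next : (i : Fin (suc n)) → toℕ i ℕ.< n → toℕ (next i) ≡ suc (toℕ i)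
toℕ-next i i<n = trans (Fin.toℕ-fromℕ< _) (ℕ.m<n⇒m%n≡m (s≤s i<n))

toℕ-next-last : (i : Fin (suc n)) → toℕ i ≡ n → toℕ (next i) ≡ 0
toℕ-next-last {n} i i≡n = trans (Fin.toℕ-fromℕ< _)
  (trans (cong (λ k → suc k ℕ.% suc n) i≡n) (ℕ.n%n≡0 (suc n)))

next-inject₁ : (i : Fin n) → next (inject₁ i) ≡ suc i
next-inject₁ i = Fin.toℕ-injective (trans
  (toℕ-next (inject₁ i) (subst (ℕ._< _) (sym (Fin.toℕ-inject₁ i)) (Fin.toℕ<n i)))
  (cong suc (Fin.toℕ-inject₁ i)))

next-fromℕ : ∀ n → next (fromℕ n) ≡ zero
next-fromℕ n = Fin.toℕ-injective (toℕ-next-last (fromℕ n) (Fin.toℕ-fromℕ n))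

sum-next : (f : Fin n → ℤ) → sum (f ∘ next) ≡ sum f
sum-next {zero}  f = refl
sum-next {suc n} f = begin
  sum (f ∘ next)
    ≡⟨ Sum.sum-init-last (f ∘ next) ⟩
  sum (λ i → f (next (inject₁ i))) + f (next (fromℕ n))
    ≡⟨ cong₂ _+_ (sum-cong (λ i → cong f (next-inject₁ i))) (cong f (next-fromℕ n)) ⟩
  sum (f ∘ suc) + f zero
    ≡⟨ ℤ.+-comm (sum (f ∘ suc)) (f zero) ⟩
  sum f ∎
  where open ≡-Reasoning

toℕ-next⁻¹ : (i : Fin n) → (toℕ (next i) ≡ suc (toℕ i)) ⊎ (suc (toℕ i) ≡ n × toℕ (next i) ≡ 0)
toℕ-next⁻¹ {suc n} i with toℕ i ℕ.<? n
... | yes i<n = inj₁ (toℕ-next i i<n)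
... | no  i≮n = inj₂ (cong suc i≡n , toℕ-next-last i i≡n)
  where i≡n = ℕ.≤-antisym (ℕ.≤-pred (Fin.toℕ<n i)) (ℕ.≮⇒≥ i≮n)

next-constant⇒constant : (f : Fin n → ℤ) → (∀ i → f i ≡ f (next i)) → ∀ i j → f i ≡ f j
next-constant⇒constant {suc n} f eq i j = trans (from-zero i) (sym (from-zero j))
  where
  from-zero : ∀ i → f i ≡ f zero
  from-zero = <-weakInduction (λ i → f i ≡ f zero) refl λ i ih →
    trans (cong f (sym (next-inject₁ i))) (trans (sym (eq (inject₁ i))) ih)

-- Evenness and semidefiniteness of the form

half-norm : Q n → ℤ
half-norm a = sum (λ i → lookup a i * lookup a i) - sum (λ i → lookup a i * lookup a (next i))

square-≥0 : ∀ x → 0ℤ ℤ.≤ x * x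
square-≥0 (+ zero)  = ℤ.≤-refl
square-≥0 (+ suc x) = ℤ.+≤+ z≤n
square-≥0 -[1+ x ]  = ℤ.+≤+ z≤n

module _ (3≤n : 3 ℕ.≤ n) where

  next-≢ : (i : Fin n) → next i ≢ i
  next-≢ i eq with toℕ-next⁻¹ i
  ... | inj₁ e = ℕ.1+n≢n (trans (sym e) (cong toℕ eq))
  ... | inj₂ (e , e₀) = ℕ.<⇒≢ (ℕ.<-≤-trans (s≤s (s≤s z≤n)) 3≤n)
    (trans (cong suc (trans (sym e₀) (cong toℕ eq))) e)

  next²-≢ : (i : Fin n) → next (next i) ≢ i
  next²-≢ i eq with toℕ-next⁻¹ i | toℕ-next⁻¹ (next i)
  ... | inj₁ e | inj₁ e′ =
    ℕ.m≢1+n+m (toℕ i) {1} (trans (sym (cong toℕ eq)) (trans e′ (cong suc e)))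
  ... | inj₁ e | inj₂ (e′ , e₀) = ℕ.<⇒≢ 3≤n
    (trans (cong (λ k → suc (suc k)) (trans (sym e₀) (cong toℕ eq))) (trans (cong suc (sym e)) e′))
  ... | inj₂ (e , e₀) | inj₁ e′ = ℕ.<⇒≢ 3≤n
    (trans (cong suc (trans (cong suc (sym e₀)) (trans (sym e′) (cong toℕ eq)))) e)
  ... | inj₂ (e , e₀) | inj₂ (e′ , e₁) = ℕ.<⇒≢ (ℕ.<-≤-trans (s≤s (s≤s z≤n)) 3≤n)
    (trans (cong suc (sym e₀)) e′)

  -- As indicators the entries can be summed by `sum-δ`. Here 3 ≤ n matters: for n = 2 the two
  -- neighbours of a vertex coincide, and the right-hand side would be -2 where `cartan` gives -1;
  -- `next²-≢` excludes this.
  cartan-δ : (i j : Fin n) → cartan i j ≡ δ i j + δ i j + - δ (next i) j + - δ (next j) i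
  cartan-δ i j with i Fin.≟ j
  ... | yes refl with next i Fin.≟ i
  ...   | yes e = ⊥-elim (next-≢ i e)
  ...   | no  _ = refl
  cartan-δ i j | no _ with next i Fin.≟ j | next j Fin.≟ i
  ...   | yes refl | yes e = ⊥-elim (next²-≢ i e)
  ...   | yes _ | no _ = refl
  ...   | no _ | yes _ = refl
  ...   | no _ | no _ = refl

  -- In the double sum the diagonal counts each square twice, and each edge of the cycle is met from
  -- both its ends.
  norm-half : (a : Q n) → ⟨ a , a ⟩ ≡ half-norm a + half-norm a
  norm-half a = begin
    ⟨ a , a ⟩
      ≡⟨ sum-cong (λ i → sum-cong (λ j → expand i j)) ⟩
    sum (λ i → sum (λ j → D i j + D i j + - N i j + - P i j))
      ≡⟨ sum-cong (λ i → trans (sum-+ (λ j → D i j + D i j + - N i j) (λ j → - P i j)) (cong₂ _+_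
           (trans (sum-+ (λ j → D i j + D i j) (λ j → - N i j)) (cong₂ _+_
             (trans (sum-+ (D i) (D i)) (cong₂ _+_ (sum-δ i (M i)) (sum-δ i (M i))))
             (trans (sum-neg (N i)) (cong -_ (sum-δ (next i) (M i))))))
           (sum-neg (P i)))) ⟩
    sum (λ i → M i i + M i i + - M i (next i) + - sum (P i))
      ≡⟨ trans (sum-+ (λ i → M i i + M i i + - M i (next i)) (λ i → - sum (P i))) (cong₂ _+_
           (trans (sum-+ (λ i → M i i + M i i) (λ i → - M i (next i)))
             (cong₂ _+_ (sum-+ (λ i → M i i) (λ i → M i i)) (sum-neg (λ i → M i (next i)))))
           (trans (sum-neg (λ i → sum (P i))) (cong -_ swap))) ⟩
    S + S + - T + - T
      ≡⟨ ring S T ⟩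
    half-norm a + half-norm a ∎
    where
    open ≡-Reasoning
    M D N P : Fin n → Fin n → ℤ
    M i j = lookup a i * lookup a j
    D i j = δ i j * M i j
    N i j = δ (next i) j * M i j
    P i j = δ (next j) i * M i j
    S = sum (λ i → M i i)
    T = sum (λ i → M i (next i))
    ring : ∀ s t → s + s + - t + - t ≡ s - t + (s - t)
    ring = solve-∀
    ring′ : ∀ m d u v → m * (d + d + - u + - v) ≡ d * m + d * m + - (u * m) + - (v * m)
    ring′ = solve-∀
    expand : ∀ i j → M i j * cartan i j ≡ D i j + D i j + - N i j + - P i j
    expand i j rewrite cartan-δ i j = ring′ (M i j) (δ i j) (δ (next i) j) (δ (next j) i)
    swap : sum (λ i → sum (P i)) ≡ T
    swap = trans (Sum.∑-comm {n} {n} P) (sum-cong λ j →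
      trans (sum-δ (next j) (λ i → M i j)) (ℤ.*-comm (lookup a (next j)) (lookup a j)))

  -- The form is the Dirichlet energy of the n-cycle. Semidefiniteness and the constancy of null
  -- vectors are read off from this, and so is the norm of an interval, which has just two unit
  -- jumps.
  norm-squares : (a : Q n) → ⟨ a , a ⟩ ≡ sum λ i →
    (lookup a i - lookup a (next i)) * (lookup a i - lookup a (next i))
  norm-squares a = sym (begin
    sum (λ i → (x i - y i) * (x i - y i))
      ≡⟨ sum-cong (λ i → ring (x i) (y i)) ⟩
    sum (λ i → (x i * x i - x i * y i) + (y i * y i - x i * y i))
      ≡⟨ trans (sum-+ (λ i → x i * x i - x i * y i) (λ i → y i * y i - x i * y i)) (cong₂ _+_
          (trans (sum-+ (λ i → x i * x i) (λ i → - (x i * y i))) (cong (λ z → S + z) (sum-neg (λ i → x i * y i))))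
          (trans (sum-+ (λ i → y i * y i) (λ i → - (x i * y i))) (cong₂ _+_ (sum-next (λ i → x i * x i)) (sum-neg (λ i → x i * y i))))) ⟩
    half-norm a + half-norm a
      ≡⟨ norm-half a ⟨
    ⟨ a , a ⟩ ∎)
    where
    open ≡-Reasoning
    x y : Fin n → ℤ
    x i = lookup a i
    y i = lookup a (next i)
    S = sum (λ i → x i * x i)
    ring : ∀ x y → (x - y) * (x - y) ≡ (x * x - x * y) + (y * y - x * y)
    ring = solve-∀

  norm-≥0 : (a : Q n) → 0ℤ ℤ.≤ ⟨ a , a ⟩
  norm-≥0 a = subst (0ℤ ℤ.≤_) (sym (norm-squares a)) (sum-≥0 _ λ i → square-≥0 (lookup a i - lookup a (next i)))

  norm-≡0⇒constant : (a : Q n) → ⟨ a , a ⟩ ≡ 0ℤ → ∀ i j → lookup a i ≡ lookup a j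
  norm-≡0⇒constant a eq = next-constant⇒constant (lookup a) λ i → ℤ.i-j≡0⇒i≡j _ _
    (square-≡0 (sum-≥0-≡0 _ (λ i → square-≥0 (lookup a i - lookup a (next i))) (trans (sym (norm-squares a)) eq) i))
    where
    square-≡0 : ∀ {x} → x * x ≡ 0ℤ → x ≡ 0ℤ
    square-≡0 {x} e with ℤ.i*j≡0⇒i≡0∨j≡0 x e
    ... | inj₁ e = e
    ... | inj₂ e = e

  -- Semidefiniteness excludes a negative half and `norm-≡0⇒constant` a zero half; the half is an
  -- integer, so it is at least 1.
  norm-≥2 : (a : Q n) {i j : Fin n} → lookup a i ≢ lookup a j → + 2 ℤ.≤ ⟨ a , a ⟩
  norm-≥2 a {i} {j} ≢ = go (half-norm a) (norm-half a)
    where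
    go : ∀ h → ⟨ a , a ⟩ ≡ h + h → + 2 ℤ.≤ ⟨ a , a ⟩
    go (+ zero) e = ⊥-elim (≢ (norm-≡0⇒constant a e i j))
    go (+ suc k) e = subst (+ 2 ℤ.≤_) (sym e) (ℤ.+≤+ (s≤s (subst (1 ℕ.≤_) (sym (ℕ.+-suc k k)) (s≤s z≤n))))
    go -[1+ k ] e = ⊥-elim (neg-not (subst (0ℤ ℤ.≤_) e (norm-≥0 a)))
      where
      neg-not : ¬ (0ℤ ℤ.≤ -[1+ k ] + -[1+ k ])
      neg-not ()

⟨⟩-linʳ : (k : ℤ) (a b d : Q n) → ⟨ d , (k · a) ⊕ b ⟩ ≡ k * ⟨ d , a ⟩ + ⟨ d , b ⟩
⟨⟩-linʳ k a b d = trans (⟨⟩-sym d ((k · a) ⊕ b)) (trans (⟨⟩-linˡ k a b d)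
  (cong₂ (λ x y → k * x + y) (⟨⟩-sym a d) (⟨⟩-sym b d)))

norm-lin : (k : ℤ) (a b : Q n) →
  ⟨ (k · a) ⊕ b , (k · a) ⊕ b ⟩ ≡ k * k * ⟨ a , a ⟩ + + 2 * k * ⟨ a , b ⟩ + ⟨ b , b ⟩
norm-lin k a b = trans (⟨⟩-linˡ k a b ((k · a) ⊕ b)) (trans
  (cong₂ (λ x y → k * x + y) (⟨⟩-linʳ k a b a) (trans (⟨⟩-linʳ k a b b) (cong (λ z → k * z + ⟨ b , b ⟩) (⟨⟩-sym b a))))
  (ring k ⟨ a , a ⟩ ⟨ a , b ⟩ ⟨ b , b ⟩))
  where
  ring : ∀ k x y z → k * (k * x + y) + (k * y + z) ≡ k * k * x + + 2 * k * y + z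
  ring = solve-∀

lookup-lin : (k : ℤ) (a b : Q n) (i : Fin n) → lookup ((k · a) ⊕ b) i ≡ k * lookup a i + lookup b i
lookup-lin k a b i = trans (lookup-⊕ (k · a) b i) (cong (_+ lookup b i) (lookup-· k a i))

⊕-lin : (a b : Q n) → a ⊕ b ≡ (1ℤ · a) ⊕ b
⊕-lin a b = lookup-inj λ i → trans (lookup-⊕ a b i)
  (sym (trans (lookup-lin 1ℤ a b i) (cong (_+ lookup b i) (ℤ.*-identityˡ (lookup a i)))))

⊖-lin : (a b : Q n) → a ⊖ b ≡ (-1ℤ · b) ⊕ a
⊖-lin a b = lookup-inj λ i → trans (lookup-⊖ a b i)
  (sym (trans (lookup-lin -1ℤ b a i) (ring (lookup a i) (lookup b i))))
  where
  ring : ∀ x y → -1ℤ * y + x ≡ x - y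
  ring = solve-∀

⟨⟩-⊕ʳ : (a b d : Q n) → ⟨ d , a ⊕ b ⟩ ≡ ⟨ d , a ⟩ + ⟨ d , b ⟩
⟨⟩-⊕ʳ a b d = trans (cong ⟨ d ,_⟩ (⊕-lin a b)) (trans (⟨⟩-linʳ 1ℤ a b d) (cong (_+ ⟨ d , b ⟩) (ℤ.*-identityˡ ⟨ d , a ⟩)))

⟨𝟎,⟩ : (d : Q n) → ⟨ 𝟎 , d ⟩ ≡ 0ℤ
⟨𝟎,⟩ d = sum-zero λ i → sum-zero λ j → cong (λ z → z * lookup d j * cartan i j) (lookup-𝟎 i)

⟨,𝟎⟩ : (d : Q n) → ⟨ d , 𝟎 ⟩ ≡ 0ℤ
⟨,𝟎⟩ d = trans (⟨⟩-sym d 𝟎) (⟨𝟎,⟩ d)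

⟨⟩-simpleRoot : (a : Q n) (k : Fin n) → ⟨ a , simpleRoot k ⟩ ≡ sum λ i → lookup a i * cartan i k
⟨⟩-simpleRoot a k = sum-cong λ i → trans
  (sum-cong λ j → trans (cong (λ z → lookup a i * z * cartan i j) (lookup-simpleRoot k j)) (ring (lookup a i) (δ k j) (cartan i j)))
  (sum-δ k (λ j → lookup a i * cartan i j))
  where
  ring : ∀ x y z → x * y * z ≡ y * (x * z)
  ring = solve-∀

⟨⟩-expand : (a b : Q n) → ⟨ a , b ⟩ ≡ sum λ k → lookup b k * ⟨ a , simpleRoot k ⟩
⟨⟩-expand {n} a b = trans (Sum.∑-comm {n} {n} _) (sum-cong λ k →
  trans (sum-cong λ i → ring (lookup a i) (lookup b k) (cartan i k))
    (trans (sum-* (lookup b k) (λ i → lookup a i * cartan i k)) (cong (lookup b k *_) (sym (⟨⟩-simpleRoot a k)))))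
  where
  ring : ∀ x y z → x * y * z ≡ y * (x * z)
  ring = solve-∀

-- Norm 2 is kept by every reflection in a root, so images of roots under words are roots without
-- recourse to the description by intervals. The record, like `Pos` and `Neg` below, lets
-- unification recover the vector from the type.
record Root (a : Q n) : Set where
  constructor root
  field
    norm≡2 : ⟨ a , a ⟩ ≡ + 2

open Root public

cartan-diagonal : (k : Fin n) → cartan k k ≡ + 2
cartan-diagonal k with k Fin.≟ k
... | yes _ = refl
... | no k≢k = ⊥-elim (k≢k refl)

simpleRoot-root : (k : Fin n) → Root (simpleRoot k)
simpleRoot-root k = root (trans (⟨⟩-simpleRoot (simpleRoot k) k) (trans
  (sum-cong λ i → cong (_* cartan i k) (lookup-simpleRoot k i))
  (trans (sum-δ k (λ i → cartan i k)) (cartan-diagonal k))))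

-- Reflections

s-lin : (α μ : Q n) → s α μ ≡ ((- ⟨ μ , α ⟩) · α) ⊕ μ
s-lin α μ = lookup-inj λ i → trans (lookup-⊖ μ _ i) (trans
  (cong (λ z → lookup μ i - z) (lookup-· ⟨ μ , α ⟩ α i))
  (sym (trans (lookup-lin (- ⟨ μ , α ⟩) α μ i) (ring ⟨ μ , α ⟩ (lookup α i) (lookup μ i)))))
  where
  ring : ∀ p x y → - p * x + y ≡ y - p * x
  ring = solve-∀

lookup-s : (α μ : Q n) (i : Fin n) → lookup (s α μ) i ≡ lookup μ i - ⟨ μ , α ⟩ * lookup α i
lookup-s α μ i = trans (lookup-⊖ μ _ i) (cong (λ z → lookup μ i - z) (lookup-· ⟨ μ , α ⟩ α i))

⟨s,⟩ : (α μ ν : Q n) → ⟨ s α μ , ν ⟩ ≡ ⟨ μ , ν ⟩ - ⟨ μ , α ⟩ * ⟨ α , ν ⟩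
⟨s,⟩ α μ ν = trans (cong ⟨_, ν ⟩ (s-lin α μ)) (trans (⟨⟩-linˡ (- ⟨ μ , α ⟩) α μ ν) (ring ⟨ μ , α ⟩ ⟨ α , ν ⟩ ⟨ μ , ν ⟩))
  where
  ring : ∀ p x y → - p * x + y ≡ y - p * x
  ring = solve-∀

⟨s,⟩≡⟨,s⟩ : (α μ ν : Q n) → ⟨ s α μ , ν ⟩ ≡ ⟨ μ , s α ν ⟩
⟨s,⟩≡⟨,s⟩ α μ ν = trans (⟨s,⟩ α μ ν) (sym (trans (⟨⟩-sym μ (s α ν)) (trans (⟨s,⟩ α ν μ)
  (trans (cong₂ (λ x y → x - y * ⟨ α , μ ⟩) (⟨⟩-sym ν μ) (⟨⟩-sym ν α))
    (cong (λ z → ⟨ μ , ν ⟩ - z) (trans (ℤ.*-comm ⟨ α , ν ⟩ ⟨ α , μ ⟩) (cong (_* ⟨ α , ν ⟩) (⟨⟩-sym α μ))))))))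

s-linear : (α : Q n) (k : ℤ) (a b : Q n) → s α ((k · a) ⊕ b) ≡ (k · s α a) ⊕ s α b
s-linear α k a b = lookup-inj λ i → trans (lookup-s α ((k · a) ⊕ b) i) (trans
  (cong₂ (λ x y → x - y * lookup α i) (lookup-lin k a b i) (⟨⟩-linˡ k a b α))
  (sym (trans (lookup-lin k (s α a) (s α b) i) (trans
    (cong₂ (λ x y → k * x + y) (lookup-s α a i) (lookup-s α b i))
    (ring k (lookup a i) (lookup b i) ⟨ a , α ⟩ ⟨ b , α ⟩ (lookup α i))))))
  where
  ring : ∀ k x y p q z → k * (x - p * z) + (y - q * z) ≡ k * x + y - (k * p + q) * z
  ring = solve-∀

s-involutive : {α : Q n} → Root α → ∀ μ → s α (s α μ) ≡ μ
s-involutive {α = α} α-root μ = lookup-inj λ i → trans (lookup-s α (s α μ) i) (trans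
  (cong₂ (λ x y → x - y * lookup α i) (lookup-s α μ i) (trans (⟨s,⟩ α μ α) (cong (λ z → ⟨ μ , α ⟩ - ⟨ μ , α ⟩ * z) (norm≡2 α-root))))
  (ring (lookup μ i) ⟨ μ , α ⟩ (lookup α i)))
  where
  ring : ∀ x p z → x - p * z - (p - p * + 2) * z ≡ x
  ring = solve-∀

s-isometry : {α : Q n} → Root α → ∀ μ ν → ⟨ s α μ , s α ν ⟩ ≡ ⟨ μ , ν ⟩
s-isometry {α = α} α-root μ ν = trans (⟨s,⟩≡⟨,s⟩ α μ (s α ν)) (cong ⟨ μ ,_⟩ (s-involutive α-root ν))

s-conj : {α : Q n} → Root α → ∀ γ → s (s α γ) ≗ s α ∘ s γ ∘ s α
s-conj {α = α} α-root γ μ = sym (begin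
  s α (s γ (s α μ))
    ≡⟨ cong (s α) (s-lin γ (s α μ)) ⟩
  s α (((- ⟨ s α μ , γ ⟩) · γ) ⊕ s α μ)
    ≡⟨ s-linear α (- ⟨ s α μ , γ ⟩) γ (s α μ) ⟩
  ((- ⟨ s α μ , γ ⟩) · s α γ) ⊕ s α (s α μ)
    ≡⟨ cong₂ (λ x y → ((- x) · s α γ) ⊕ y) (⟨s,⟩≡⟨,s⟩ α μ γ) (s-involutive α-root μ) ⟩
  ((- ⟨ μ , s α γ ⟩) · s α γ) ⊕ μ
    ≡⟨ s-lin (s α γ) μ ⟨
  s (s α γ) μ ∎)
  where open ≡-Reasoning

-- Signs of roots

record Pos (a : Q n) : Set where
  constructor nonnegative
  field
    nonneg : ∀ i → 0ℤ ℤ.≤ lookup a i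

record Neg (a : Q n) : Set where
  constructor nonpositive
  field
    nonpos : ∀ i → lookup a i ℤ.≤ 0ℤ

open Pos public
open Neg public

Disjoint : Q n → Q n → Set
Disjoint a b = ∀ i → lookup a i ≡ 0ℤ ⊎ lookup b i ≡ 0ℤ

*-nonneg-nonneg : ∀ {x y} → 0ℤ ℤ.≤ x → 0ℤ ℤ.≤ y → 0ℤ ℤ.≤ x * y
*-nonneg-nonneg {+ x} {+ y} _ _ = subst (0ℤ ℤ.≤_) (ℤ.pos-* x y) (ℤ.+≤+ z≤n)

*-nonneg-nonpos : ∀ {x y} → 0ℤ ℤ.≤ x → y ℤ.≤ 0ℤ → x * y ℤ.≤ 0ℤ
*-nonneg-nonpos {+ x} {y} _ y≤0 = subst (+ x * y ℤ.≤_) (ℤ.*-zeroʳ (+ x)) (ℤ.*-monoˡ-≤-nonNeg (+ x) y≤0)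

-- Disjointness kills the diagonal terms, and the entries of `cartan` off the diagonal are at most
-- 0.
disjoint-≤0 : (a b : Q n) → Pos a → Pos b → Disjoint a b → ⟨ a , b ⟩ ℤ.≤ 0ℤ
disjoint-≤0 a b a≥0 b≥0 dis = sum-≤0 _ λ i → sum-≤0 _ λ j → term i j
  where
  term : ∀ i j → lookup a i * lookup b j * cartan i j ℤ.≤ 0ℤ
  term i j = [ equal , (λ i≢j → *-nonneg-nonpos (*-nonneg-nonneg (nonneg a≥0 i) (nonneg b≥0 j)) (cartan-≤0 i≢j)) ]′ (toSum (i Fin.≟ j))
    where
    equal : i ≡ j → lookup a i * lookup b j * cartan i j ℤ.≤ 0ℤ
    equal refl with dis i
    ... | inj₁ e rewrite e = ℤ.≤-refl
    ... | inj₂ e rewrite e | ℤ.*-zeroʳ (lookup a i) = ℤ.≤-refl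

root-≢0 : {a : Q n} → Root a → ∃ λ i → lookup a i ≢ 0ℤ
root-≢0 {n} {a} a-root = Fin.¬∀⟶∃¬ n _ (λ i → lookup a i ℤ.≟ 0ℤ) λ a≡0 →
  0≢2 (trans (sym (⟨𝟎,⟩ a)) (trans (cong ⟨_, a ⟩ (lookup-inj {a = 𝟎} {a} λ i → trans (lookup-𝟎 i) (sym (a≡0 i)))) (norm≡2 a-root)))
  where
  0≢2 : 0ℤ ≢ + 2
  0≢2 ()

module _ (3≤n : 3 ℕ.≤ n) where

  -- A vector with entries of both signs has norm at least 4: its positive and
  -- negative parts have norm at least 2 each and pair non-positively.
  sign-coherent : {a : Q n} → Root a → ∀ {i j} → 0ℤ ℤ.< lookup a i → ¬ lookup a j ℤ.< 0ℤ
  sign-coherent {a} a-root {i} {j} 0<aᵢ aⱼ<0 = ℤ.<⇒≱ (ℤ.+<+ (s≤s (s≤s (s≤s z≤n)))) (subst (+ 4 ℤ.≤_) (norm≡2 a-root) 4≤)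
    where
    p m : Q n
    p = tabulate λ i → lookup a i ℤ.⊔ 0ℤ
    m = tabulate λ i → (- lookup a i) ℤ.⊔ 0ℤ
    pᵢ : ∀ i → lookup p i ≡ lookup a i ℤ.⊔ 0ℤ
    pᵢ i = lookup∘tabulate _ i
    mᵢ : ∀ i → lookup m i ≡ (- lookup a i) ℤ.⊔ 0ℤ
    mᵢ i = lookup∘tabulate _ i
    split : ∀ x → x ≡ -1ℤ * ((- x) ℤ.⊔ 0ℤ) + (x ℤ.⊔ 0ℤ)
    split (+ zero)  = refl
    split (+ suc x) = refl
    split -[1+ x ]  = cong -[1+_] (sym (ℕ.+-identityʳ x))
    a≡ : a ≡ (-1ℤ · m) ⊕ p
    a≡ = lookup-inj λ i → trans (split (lookup a i))
      (sym (trans (lookup-lin -1ℤ m p i) (cong₂ (λ x y → -1ℤ * x + y) (mᵢ i) (pᵢ i))))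
    dis : Disjoint m p
    dis i = subst₂ (λ x y → x ≡ 0ℤ ⊎ y ≡ 0ℤ) (sym (mᵢ i)) (sym (pᵢ i)) (go (lookup a i))
      where
      go : ∀ x → (- x) ℤ.⊔ 0ℤ ≡ 0ℤ ⊎ x ℤ.⊔ 0ℤ ≡ 0ℤ
      go (+ zero)  = inj₁ refl
      go (+ suc x) = inj₁ refl
      go -[1+ x ]  = inj₂ refl
    ≥0 : ∀ x → 0ℤ ℤ.≤ x ℤ.⊔ 0ℤ
    ≥0 x = ℤ.i≤j⊔i x 0ℤ
    p-norm : + 2 ℤ.≤ ⟨ p , p ⟩
    p-norm = norm-≥2 3≤n p {i} {j} λ e → ℤ.<⇒≢ 0<aᵢ (sym (trans (sym (ℤ.i≥j⇒i⊔j≡i (ℤ.<⇒≤ 0<aᵢ)))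
      (trans (sym (pᵢ i)) (trans e (trans (pᵢ j) (ℤ.i≤j⇒i⊔j≡j (ℤ.<⇒≤ aⱼ<0)))))))
    m-norm : + 2 ℤ.≤ ⟨ m , m ⟩
    m-norm = norm-≥2 3≤n m {j} {i} λ e → ℤ.<⇒≢ (ℤ.neg-mono-< aⱼ<0) (sym (trans (sym (ℤ.i≥j⇒i⊔j≡i (ℤ.<⇒≤ (ℤ.neg-mono-< aⱼ<0))))
      (trans (sym (mᵢ j)) (trans e (trans (mᵢ i) (ℤ.i≤j⇒i⊔j≡j (ℤ.<⇒≤ (ℤ.neg-mono-< 0<aᵢ))))))))
    ring : ∀ x y z → -1ℤ * -1ℤ * x + + 2 * -1ℤ * y + z ≡ (x + z) + + 2 * (- y)
    ring = solve-∀
    4≤ : + 4 ℤ.≤ ⟨ a , a ⟩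
    4≤ = subst (+ 4 ℤ.≤_) (sym (trans (cong (λ x → ⟨ x , x ⟩) a≡) (trans (norm-lin -1ℤ m p) (ring ⟨ m , m ⟩ ⟨ m , p ⟩ ⟨ p , p ⟩))))
      (ℤ.+-mono-≤ {+ 4} {⟨ m , m ⟩ + ⟨ p , p ⟩} {0ℤ} (ℤ.+-mono-≤ m-norm p-norm)
        (*-nonneg-nonneg {+ 2} (ℤ.+≤+ z≤n) (ℤ.neg-mono-≤
          (disjoint-≤0 m p (nonnegative λ i → subst (0ℤ ℤ.≤_) (sym (mᵢ i)) (≥0 _))
                           (nonnegative λ i → subst (0ℤ ℤ.≤_) (sym (pᵢ i)) (≥0 _)) dis))))

  root->0⇒pos : {a : Q n} → Root a → ∀ {i} → 0ℤ ℤ.< lookup a i → Pos a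
  root->0⇒pos a-root {i} 0<aᵢ = nonnegative λ j → ℤ.≮⇒≥ (sign-coherent a-root {i} {j} 0<aᵢ)

  root-<0⇒neg : {a : Q n} → Root a → ∀ {i} → lookup a i ℤ.< 0ℤ → Neg a
  root-<0⇒neg a-root {i} aᵢ<0 = nonpositive λ j → ℤ.≮⇒≥ λ 0<aⱼ → sign-coherent a-root {j} {i} 0<aⱼ aᵢ<0

  pos⊎neg : {a : Q n} → Root a → Pos a ⊎ Neg a
  pos⊎neg {a} a-root with root-≢0 a-root
  ... | i , aᵢ≢0 with ℤ.<-cmp (lookup a i) 0ℤ
  ...   | tri< aᵢ<0 _ _ = inj₂ (root-<0⇒neg a-root {i} aᵢ<0)
  ...   | tri≈ _ aᵢ≡0 _ = ⊥-elim (aᵢ≢0 aᵢ≡0)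
  ...   | tri> _ _ 0<aᵢ = inj₁ (root->0⇒pos a-root {i} 0<aᵢ)

sum>0⇒∃>0 : (f : Fin n → ℤ) → 0ℤ ℤ.< sum f → ∃ λ i → 0ℤ ℤ.< f i
sum>0⇒∃>0 {n} f 0<sum with Fin.¬∀⟶∃¬ n _ (λ i → f i ℤ.≤? 0ℤ) (λ f≤0 → ℤ.<⇒≱ 0<sum (sum-≤0 f f≤0))
... | i , fᵢ≰0 = i , ℤ.≰⇒> fᵢ≰0

-- T singles out at most one entry, so discarding it costs at most one. For a word i ∷ w, T says
-- that w sends the root to αᵢ: the single inversion that the letter i can add. The sublist relation
-- carries distinctness from the head through the recursion.
remove-one : {A : Set} {P T : Pred A 0ℓ} → (∀ {x y} → T x → T y → x ≡ y) →
  ∀ xs → Unique xs → All (λ x → P x ⊎ T x) xs →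
  ∃ λ ys → Unique ys × All P ys × ys ⊆ xs × length xs ℕ.≤ suc (length ys)
remove-one T-prop [] _ _ = [] , [] , [] , [] , z≤n
remove-one {P = P} {T} T-prop (x ∷ xs) (x∉ ∷ unique) (inj₂ Tx ∷ all) =
  xs , unique , All.zipWith keep (x∉ , all) , x ∷ʳ ⊆-refl , ℕ.≤-refl
  where
  keep : ∀ {y} → x ≢ y × (P y ⊎ T y) → P y
  keep (x≢y , inj₁ Py) = Py
  keep (x≢y , inj₂ Ty) = ⊥-elim (x≢y (T-prop Tx Ty))
remove-one T-prop (x ∷ xs) (x∉ ∷ unique) (inj₁ Px ∷ all) with remove-one T-prop xs unique all
... | ys , unique′ , allP , ys⊆xs , len =
  x ∷ ys , All-resp-⊆ ys⊆xs x∉ ∷ unique′ , Px ∷ allP , refl ∷ ys⊆xs , s≤s len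

-- Words acting on roots

⟦⟧-++ : (v w : List (Fin n)) → ⟦ v ++ w ⟧ ≗ ⟦ v ⟧ ∘ ⟦ w ⟧
⟦⟧-++ []      w μ = refl
⟦⟧-++ (i ∷ v) w μ = cong (s (simpleRoot i)) (⟦⟧-++ v w μ)

s-root : {α r : Q n} → Root α → Root r → Root (s α r)
s-root {r = r} α-root r-root = root (trans (s-isometry α-root r r) (norm≡2 r-root))

⟦⟧-root : (w : List (Fin n)) {r : Q n} → Root r → Root (⟦ w ⟧ r)
⟦⟧-root []      r-root = r-root
⟦⟧-root (i ∷ w) r-root = s-root (simpleRoot-root i) (⟦⟧-root w r-root)

s-injective : {α : Q n} → Root α → ∀ {μ ν} → s α μ ≡ s α ν → μ ≡ ν
s-injective {α = α} α-root {μ} {ν} eq = trans (sym (s-involutive α-root μ)) (trans (cong (s α) eq) (s-involutive α-root ν))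

⟦⟧-injective : (w : List (Fin n)) {μ ν : Q n} → ⟦ w ⟧ μ ≡ ⟦ w ⟧ ν → μ ≡ ν
⟦⟧-injective []      eq = eq
⟦⟧-injective (i ∷ w) eq = ⟦⟧-injective w (s-injective (simpleRoot-root i) eq)

simpleRoot-self : (i : Fin n) → lookup (simpleRoot i) i ≡ 1ℤ
simpleRoot-self i = trans (lookup-simpleRoot i i) (δ-≡ refl)

simpleRoot-other : {i k : Fin n} → i ≢ k → lookup (simpleRoot i) k ≡ 0ℤ
simpleRoot-other {i = i} {k} i≢k = trans (lookup-simpleRoot i k) (δ-≢ i≢k)

simpleRoot-0/1 : (i k : Fin n) → lookup (simpleRoot i) k ≡ 0ℤ ⊎ (i ≡ k × lookup (simpleRoot i) k ≡ 1ℤ)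
simpleRoot-0/1 i k with toSum (i Fin.≟ k)
... | inj₁ refl = inj₂ (refl , simpleRoot-self i)
... | inj₂ i≢k  = inj₁ (simpleRoot-other i≢k)

simpleRoot-pos : (i : Fin n) → Pos (simpleRoot i)
simpleRoot-pos i = nonnegative λ k →
  [ (λ e → ℤ.≤-reflexive (sym e)) , (λ (_ , e) → subst (0ℤ ℤ.≤_) (sym e) (ℤ.+≤+ z≤n)) ]′ (simpleRoot-0/1 i k)

pos-neg-⊥ : {r : Q n} → Root r → Pos r → ¬ Neg r
pos-neg-⊥ r-root r≥0 r≤0 with root-≢0 r-root
... | i , rᵢ≢0 = rᵢ≢0 (ℤ.≤-antisym (nonpos r≤0 i) (nonneg r≥0 i))

-- Since a root has one sign, a nonzero coefficient outside the support of d decides the sign of its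
-- image under u.
record Fixes (d : Q n) (u : Q n → Q n) : Set where
  constructor fixes
  field
    fixed : ∀ μ i → lookup d i ≡ 0ℤ → lookup (u μ) i ≡ lookup μ i

open Fixes public

s-fixes : (α : Q n) → Fixes α (s α)
s-fixes α = fixes λ μ i αᵢ≡0 → trans (lookup-s α μ i) (trans (cong (λ z → lookup μ i - ⟨ μ , α ⟩ * z) αᵢ≡0) (ring (lookup μ i) ⟨ μ , α ⟩))
  where
  ring : ∀ x p → x - p * 0ℤ ≡ x
  ring = solve-∀

square-1 : ∀ {x} → 0ℤ ℤ.≤ x → x * x * + 2 ≡ + 2 → x ≡ 1ℤ
square-1 {+ 0} _ ()
square-1 {+ 1} _ _ = refl
square-1 {+ suc (suc k)} _ ()

-- The reflection changes only coefficient i, so every other coefficient of r is both ≥ 0 and ≤ 0.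
-- Hence r is a multiple of αᵢ, and norm 2 with rᵢ ≥ 0 makes it αᵢ.
made-negative⇒simple : {i : Fin n} {r : Q n} → Root r → Pos r → Neg (s (simpleRoot i) r) → r ≡ simpleRoot i
made-negative⇒simple {n} {i} {r} r-root r≥0 sr≤0 =
  trans r≡ (trans (cong (λ k → (k · α) ⊕ 𝟎) (square-1 (nonneg r≥0 i) rᵢ²≡1)) (lookup-inj λ k →
    trans (lookup-lin 1ℤ α 𝟎 k) (trans (cong (λ z → 1ℤ * lookup α k + z) (lookup-𝟎 k)) (ring₁ (lookup α k)))))
  where
  α = simpleRoot i
  ring₁ : ∀ x → 1ℤ * x + 0ℤ ≡ x
  ring₁ = solve-∀
  ring₂ : ∀ x → x * 1ℤ + 0ℤ ≡ x
  ring₂ = solve-∀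
  ring₃ : ∀ x → x * 0ℤ + 0ℤ ≡ 0ℤ
  ring₃ = solve-∀
  r≡ : r ≡ (lookup r i · α) ⊕ 𝟎
  r≡ = lookup-inj λ k → sym (trans (lookup-lin (lookup r i) α 𝟎 k) (trans
    (cong (λ z → lookup r i * lookup α k + z) (lookup-𝟎 k)) (coord k (simpleRoot-0/1 i k))))
    where
    coord : ∀ k → lookup α k ≡ 0ℤ ⊎ (i ≡ k × lookup α k ≡ 1ℤ) → lookup r i * lookup α k + 0ℤ ≡ lookup r k
    coord k (inj₂ (refl , e)) = trans (cong (λ z → lookup r i * z + 0ℤ) e) (ring₂ (lookup r i))
    coord k (inj₁ e) = trans (cong (λ z → lookup r i * z + 0ℤ) e) (trans (ring₃ (lookup r i))
      (ℤ.≤-antisym (nonneg r≥0 k) (subst (ℤ._≤ 0ℤ) (fixed (s-fixes α) r k e) (nonpos sr≤0 k))))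
  ring₄ : ∀ k → k * k * + 2 ≡ k * k * + 2 + + 2 * k * 0ℤ + 0ℤ
  ring₄ = solve-∀
  rᵢ²≡1 : lookup r i * lookup r i * + 2 ≡ + 2
  rᵢ²≡1 = trans (ring₄ (lookup r i)) (trans (sym (trans (norm-lin (lookup r i) α 𝟎)
    (cong₂ _+_ (cong₂ _+_ (cong (lookup r i * lookup r i *_) (norm≡2 (simpleRoot-root i)))
      (cong (+ 2 * lookup r i *_) (⟨,𝟎⟩ α))) (⟨,𝟎⟩ (𝟎 {n})))))
    (trans (cong (λ x → ⟨ x , x ⟩) (sym r≡)) (norm≡2 r-root)))

-- Inversions

record Inversion (u : Q n → Q n) (r : Q n) : Set where
  constructor inversion
  field
    isRoot   : Root r
    positive : Pos r
    negative : Neg (u r)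

-- These are N distinct inversions, possibly not all: a lower bound for the length, which `Size`
-- pairs with a word as the upper bound.
Inversions : (Q n → Q n) → ℕ → Set
Inversions u N = ∃ λ R → Unique R × All (Inversion u) R × length R ≡ N

open Inversion using (negative; positive)

inversion-support : {d : Q n} {u : Q n → Q n} → Fixes d u → ∀ {r} → Inversion u r →
  ∀ i → lookup d i ≡ 0ℤ → lookup r i ≡ 0ℤ
inversion-support fix {r} inv i dᵢ≡0 =
  ℤ.≤-antisym (subst (ℤ._≤ 0ℤ) (fixed fix r i dᵢ≡0) (nonpos (negative inv) i)) (nonneg (positive inv) i)

-- A nonzero coefficient of r lies in the support of d by `inversion-support`, hence outside that of
-- γ, where `s γ` keeps it. It shows that `s γ r` is positive and that it is no inversion of `s γ`.
inversion-witness : {d γ : Q n} {u : Q n → Q n} → Fixes d u → Disjoint d γ → ∀ {r} → Inversion u r →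
  ∃ λ i → lookup γ i ≡ 0ℤ × 0ℤ ℤ.< lookup (s γ r) i
inversion-witness {d = d} {γ = γ} fix dis {r} inv with root-≢0 (Inversion.isRoot inv)
... | i , rᵢ≢0 with dis i
...   | inj₁ dᵢ≡0 = ⊥-elim (rᵢ≢0 (inversion-support fix inv i dᵢ≡0))
...   | inj₂ γᵢ≡0 = i , γᵢ≡0 , subst (0ℤ ℤ.<_) (sym (fixed (s-fixes γ) r i γᵢ≡0))
  (ℤ.≤∧≢⇒< (nonneg (positive inv) i) (λ e → rᵢ≢0 (sym e)))

module _ (3≤n : 3 ℕ.≤ n) where

  open Inversion using (isRoot)

  inversion-∷ : ∀ {i w r} → Inversion ⟦ i ∷ w ⟧ r → Inversion ⟦ w ⟧ r ⊎ ⟦ w ⟧ r ≡ simpleRoot i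
  inversion-∷ {w = w} (inversion r-root r≥0 sr≤0) with pos⊎neg 3≤n (⟦⟧-root w r-root)
  ... | inj₁ wr≥0 = inj₂ (made-negative⇒simple (⟦⟧-root w r-root) wr≥0 sr≤0)
  ... | inj₂ wr≤0 = inj₁ (inversion r-root r≥0 wr≤0)

  inversions-≤-length : ∀ w (R : List (Q n)) → Unique R → All (Inversion ⟦ w ⟧) R → length R ℕ.≤ length w
  inversions-≤-length []      []      _ _ = z≤n
  inversions-≤-length []      (r ∷ R) _ (inversion r-root r≥0 r≤0 ∷ _) = ⊥-elim (pos-neg-⊥ r-root r≥0 r≤0)
  inversions-≤-length (i ∷ w) R unique invs
    with remove-one {P = Inversion ⟦ w ⟧} {T = λ r → ⟦ w ⟧ r ≡ simpleRoot i}
           (λ e e′ → ⟦⟧-injective w (trans e (sym e′))) R unique (All.map (inversion-∷ {w = w}) invs)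
  ... | R′ , unique′ , invs′ , _ , len = ℕ.≤-trans len (s≤s (inversions-≤-length w R′ unique′ invs′))

  -- The list consists of the inversions of `s γ` and the images under `s γ` of those of u. Disjoint
  -- supports prevent cancellation; the two kinds differ because the first live inside the support
  -- of γ while the second are nonzero somewhere outside it.
  inversions-∘ : {d γ : Q n} {u : Q n → Q n} → Fixes d u → (∀ {r} → Root r → Root (u r)) →
    Root γ → Disjoint d γ → ∀ {M N} → Inversions (s γ) M → Inversions u N → Inversions (u ∘ s γ) (M ℕ.+ N)
  inversions-∘ {d} {γ} {u} fix u-root γ-root dis (R , unique , invs , refl) (R′ , unique′ , invs′ , refl) =
    R ++ List.map (s γ) R′ ,
    Unique.++⁺ unique (Unique.map⁺ (s-injective γ-root) unique′) apart ,
    All.++⁺ (All.map fromγ invs) (All.map⁺ (All.map fromu invs′)) ,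
    trans (List.length-++ R) (cong (length R ℕ.+_) (List.length-map (s γ) R′))
    where
    apart : ∀ {x} → ¬ (x List.∈ R × x List.∈ List.map (s γ) R′)
    apart (x∈R , x∈R′) with ∈-map⁻ (s γ) x∈R′
    ... | r , r∈R′ , refl with inversion-witness fix dis (All.lookup invs′ r∈R′)
    ...   | i , γᵢ≡0 , 0<sr = ℤ.<-irrefl (sym (inversion-support (s-fixes γ) (All.lookup invs x∈R) i γᵢ≡0)) 0<sr
    fromu : ∀ {r} → Inversion u r → Inversion (u ∘ s γ) (s γ r)
    fromu {r} inv with inversion-witness fix dis inv
    ... | i , _ , 0<sr = inversion sr-root (root->0⇒pos 3≤n sr-root {i} 0<sr)
      (subst (Neg ∘ u) (sym (s-involutive γ-root r)) (negative inv))
      where sr-root = s-root γ-root (isRoot inv)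
    -- Take a nonzero coefficient of `s γ r`. Outside the support of d its sign is preserved by u;
    -- it cannot lie outside the support of γ, where r and thus `s γ r` vanish.
    fromγ : ∀ {r} → Inversion (s γ) r → Inversion (u ∘ s γ) r
    fromγ {r} inv = from-coordinate (root-≢0 sr-root)
      where
      sr-root = s-root γ-root (isRoot inv)
      from-coordinate : (∃ λ i → lookup (s γ r) i ≢ 0ℤ) → Inversion (u ∘ s γ) r
      from-coordinate (i , srᵢ≢0) = inversion (isRoot inv) (positive inv) ([ in-d , in-γ ]′ (dis i))
        where
        in-d : lookup d i ≡ 0ℤ → Neg (u (s γ r))
        in-d dᵢ≡0 = root-<0⇒neg 3≤n (u-root sr-root) {i} (subst (ℤ._< 0ℤ)
          (sym (fixed fix (s γ r) i dᵢ≡0)) (ℤ.≤∧≢⇒< (nonpos (negative inv) i) srᵢ≢0))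
        in-γ : lookup γ i ≡ 0ℤ → Neg (u (s γ r))
        in-γ γᵢ≡0 = ⊥-elim (srᵢ≢0 (trans (fixed (s-fixes γ) r i γᵢ≡0) (inversion-support (s-fixes γ) inv i γᵢ≡0)))

-- Reflections in roots below c

record SmallRoot (β : Q n) : Set where
  field
    isRoot  : Root β
    isPos   : Pos β
    bounded : ∀ i → lookup β i ℤ.≤ 1ℤ

ht : Q n → ℤ
ht β = sum (lookup β)

ht-⊕ : (a b : Q n) → ht (a ⊕ b) ≡ ht a + ht b
ht-⊕ a b = trans (sum-cong (lookup-⊕ a b)) (sum-+ (lookup a) (lookup b))

ht-simpleRoot : (k : Fin n) → ht (simpleRoot k) ≡ 1ℤ
ht-simpleRoot k = trans (sum-cong (lookup-simpleRoot k)) (sum-δ-1 k)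

Word : (Q n → Q n) → ℕ → Set
Word u k = ∃ λ w → u ≗ ⟦ w ⟧ × length w ≡ k

Size : (Q n → Q n) → ℕ → Set
Size u k = Word u k × Inversions u k

Inversions-resp : {u v : Q n → Q n} {N : ℕ} → u ≗ v → Inversions u N → Inversions v N
Inversions-resp u≗v (R , unique , invs , len) = R , unique ,
  All.map (λ {r} inv → inversion (isRoot inv) (positive inv) (subst Neg (u≗v r) (negative inv))) invs , len
  where open Inversion

Size-resp : {u v : Q n → Q n} {N : ℕ} → u ≗ v → Size u N → Size v N
Size-resp u≗v ((w , eq , len) , invs) = (w , (λ μ → trans (sym (u≗v μ)) (eq μ)) , len) , Inversions-resp u≗v invs

Word-∘ : {u v : Q n → Q n} {k l : ℕ} → Word u k → Word v l → Word (u ∘ v) (k ℕ.+ l)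
Word-∘ {u = u} (w , eq , refl) (w′ , eq′ , refl) = w ++ w′ ,
  (λ μ → trans (cong u (eq′ μ)) (trans (eq (⟦ w′ ⟧ μ)) (sym (⟦⟧-++ w w′ μ)))) , List.length-++ w

Reflection-resp : {t t′ : Q n → Q n} → t ≗ t′ → t ∈ Reflection → t′ ∈ Reflection
Reflection-resp t≗t′ (w , i , eq) = w , i , λ μ → trans (sym (t≗t′ μ)) (eq μ)

Reflection-simple : (i : Fin n) → s (simpleRoot i) ∈ Reflection
Reflection-simple i = [] , i , λ μ → refl

Reflection-conj-simple : {t : Q n → Q n} (i : Fin n) → t ∈ Reflection → s (simpleRoot i) ∘ t ∘ s (simpleRoot i) ∈ Reflection
Reflection-conj-simple {n} {t} i (w , j , eq) = i ∷ w , j , λ μ → cong (s (simpleRoot i)) (begin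
  t (s (simpleRoot i) μ)
    ≡⟨ eq (s (simpleRoot i) μ) ⟩
  ⟦ w ++ [ j ] ++ reverse w ⟧ (⟦ [ i ] ⟧ μ)
    ≡⟨ ⟦⟧-++ (w ++ [ j ] ++ reverse w) [ i ] μ ⟨
  ⟦ (w ++ [ j ] ++ reverse w) ++ [ i ] ⟧ μ
    ≡⟨ cong (λ v → ⟦ v ⟧ μ) (trans (List.++-assoc w ([ j ] ++ reverse w) [ i ])
         (cong (λ v → w ++ [ j ] ++ v) (sym (List.unfold-reverse i w)))) ⟩
  ⟦ w ++ [ j ] ++ reverse (i ∷ w) ⟧ μ ∎)
  where open ≡-Reasoning

simpleRoot-inversions : (i : Fin n) → Inversions (s (simpleRoot i)) 1
simpleRoot-inversions i = [ α ] , [] ∷ [] , inversion α-root (simpleRoot-pos i) (nonpositive λ k →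
    subst (ℤ._≤ 0ℤ) (sym (trans (lookup-s α α k) (trans (cong (λ z → lookup α k - z * lookup α k) (norm≡2 α-root)) (ring (lookup α k)))))
      (ℤ.neg-mono-≤ (nonneg (simpleRoot-pos i) k))) ∷ [] , refl
  where
  α = simpleRoot i
  α-root = simpleRoot-root i
  ring : ∀ x → x - + 2 * x ≡ - x
  ring = solve-∀

-- With β′ = β - αᵢ, the identity s_β = s_i s_β′ s_i lengthens a word for s_β′ by two letters. Two
-- new inversions must match them: αᵢ comes from multiplying by s_i on the right, β′ from
-- multiplying on the left. The condition βᵢ = 1 makes β′ disjoint from αᵢ, so that `inversions-∘`
-- handles the first multiplication.
module Peel (3≤n : 3 ℕ.≤ n) (i : Fin n) (β : Q n) (β-root : Root β) (β-pos : Pos β)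
            (βᵢ≡1 : lookup β i ≡ 1ℤ) (⟨β,α⟩≡1 : ⟨ β , simpleRoot i ⟩ ≡ 1ℤ) where

  α β′ : Q n
  α  = simpleRoot i
  β′ = s α β

  α-root : Root α
  α-root = simpleRoot-root i

  lookup-β′ : ∀ k → lookup β′ k ≡ lookup β k - lookup α k
  lookup-β′ k = trans (lookup-s α β k) (cong (λ z → lookup β k - z) (trans (cong (_* lookup α k) ⟨β,α⟩≡1) (ℤ.*-identityˡ (lookup α k))))

  β′-root : Root β′
  β′-root = s-root α-root β-root

  β′-pos : Pos β′
  β′-pos = nonnegative λ k →
    [ (λ e → subst (0ℤ ℤ.≤_)
        (sym (trans (lookup-β′ k) (trans (cong (λ z → lookup β k - z) e) (ℤ.+-identityʳ (lookup β k)))))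
        (nonneg β-pos k))
    , (λ { (refl , e) → ℤ.≤-reflexive (sym (trans (lookup-β′ i) (cong₂ _-_ βᵢ≡1 e))) })
    ]′ (simpleRoot-0/1 i k)

  β′-disjoint : Disjoint β′ α
  β′-disjoint k = [ inj₂ , (λ { (refl , e) → inj₁ (trans (lookup-β′ i) (cong₂ _-_ βᵢ≡1 e)) }) ]′ (simpleRoot-0/1 i k)

  sα-β′ : s α β′ ≡ β
  sα-β′ = s-involutive α-root β

  conj : s β ≗ s α ∘ s β′ ∘ s α
  conj μ = trans (cong (λ b → s b μ) (sym sα-β′)) (s-conj α-root β′ μ)

  ⟨β′,β⟩≡1 : ⟨ β′ , β ⟩ ≡ 1ℤ
  ⟨β′,β⟩≡1 = trans (⟨s,⟩ α β β) (cong₂ _-_ (norm≡2 β-root) (cong₂ _*_ ⟨β,α⟩≡1 (trans (⟨⟩-sym α β) ⟨β,α⟩≡1)))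

  sβ-β′≤0 : Neg (s β β′)
  sβ-β′≤0 = nonpositive λ k → subst (ℤ._≤ 0ℤ)
    (sym (trans (lookup-s β β′ k) (trans (cong₂ (λ x y → x - y * lookup β k) (lookup-β′ k) ⟨β′,β⟩≡1) (ring (lookup β k) (lookup α k)))))
    (ℤ.neg-mono-≤ (nonneg (simpleRoot-pos i) k))
    where
    ring : ∀ x y → x - y - 1ℤ * x ≡ - y
    ring = solve-∀

  sβ′-β : s β′ (s α β′) ≡ α
  sβ′-β = trans (cong (s β′) sα-β′) (lookup-inj λ k → trans (lookup-s β′ β k)
    (trans (cong₂ (λ x y → lookup β k - x * y) (trans (⟨⟩-sym β β′) ⟨β′,β⟩≡1) (lookup-β′ k)) (ring (lookup β k) (lookup α k))))
    where
    ring : ∀ x y → x - 1ℤ * (x - y) ≡ y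
    ring = solve-∀

  sβ-α≤0 : Neg (s β α)
  sβ-α≤0 = nonpositive λ k → subst (ℤ._≤ 0ℤ)
    (sym (trans (lookup-s β α k) (trans (cong (λ z → lookup α k - z * lookup β k) (trans (⟨⟩-sym α β) ⟨β,α⟩≡1))
      (trans (ring (lookup α k) (lookup β k)) (cong -_ (sym (lookup-β′ k)))))))
    (ℤ.neg-mono-≤ (nonneg β′-pos k))
    where
    ring : ∀ x y → x - 1ℤ * y ≡ - (y - x)
    ring = solve-∀

  -- Multiplying by s_i on the left can destroy only an inversion that was sent to -αᵢ. Such an r
  -- equals s_β(αᵢ) = -β′, which is not positive.
  inversion-extend : ∀ {r} → Inversion (s β′ ∘ s α) r → Inversion (s β) r
  inversion-extend {r} (inversion r-root r≥0 ur≤0) =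
    inversion r-root r≥0 ([ (λ sr≥0 → ⊥-elim (contra sr≥0)) , id ]′ (pos⊎neg 3≤n sr-root))
    where
    sr-root : Root (s β r)
    sr-root = s-root β-root r-root
    contra : ¬ Pos (s β r)
    contra sr≥0 = pos-neg-⊥ r-root r≥0 (subst Neg (sym r≡) sβ-α≤0)
      where
      sr≡α : s β r ≡ α
      sr≡α = made-negative⇒simple sr-root sr≥0
        (subst Neg (sym (trans (cong (s α) (conj r)) (s-involutive α-root (s β′ (s α r))))) ur≤0)
      r≡ : r ≡ s β α
      r≡ = trans (sym (s-involutive β-root r)) (cong (s β) sr≡α)

  inversions-extend : ∀ {N} → Inversions (s β′) N → Inversions (s β) (2 ℕ.+ N)
  inversions-extend invs′ = extend
    (inversions-∘ 3≤n {β′} {α} (s-fixes β′) (s-root β′-root) α-root β′-disjoint (simpleRoot-inversions i) invs′)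
    where
    extend : ∀ {N} → Inversions (s β′ ∘ s α) N → Inversions (s β) (suc N)
    extend (R , unique , invs , len) =
      β′ ∷ R ,
      All.map new invs ∷ unique ,
      inversion β′-root β′-pos sβ-β′≤0 ∷ All.map inversion-extend invs ,
      cong suc len
      where
      -- `s β′ ∘ s α` sends β′ to the positive root α, so β′ is not yet in the list.
      new : ∀ {r} → Inversion (s β′ ∘ s α) r → β′ ≢ r
      new inv refl = pos-neg-⊥ α-root (simpleRoot-pos i) (subst Neg sβ′-β (Inversion.negative inv))

  size-extend : ∀ {N} → Size (s β′) N → Size (s β) (2 ℕ.+ N)
  size-extend {N} (word , invs) = Size-resp (λ μ → sym (conj μ))
    (subst (Word _) (cong suc (ℕ.+-comm N 1)) (Word-∘ α-word (Word-∘ word α-word)) ,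
     Inversions-resp conj (inversions-extend invs))
    where
    α-word : Word (s α) 1
    α-word = [ i ] , (λ _ → refl) , refl

  reflection-extend : s β′ ∈ Reflection → s β ∈ Reflection
  reflection-extend t∈ = Reflection-resp (λ μ → sym (conj μ)) (Reflection-conj-simple i t∈)

  ht-β′ : ht β ≡ 1ℤ + ht β′
  ht-β′ = trans (cong ht (lookup-inj {a = β} {α ⊕ β′} λ k → sym (trans (lookup-⊕ α β′ k)
    (trans (cong (λ z → lookup α k + z) (lookup-β′ k)) (ring (lookup α k) (lookup β k))))))
    (trans (ht-⊕ α β′) (cong (_+ ht β′) (ht-simpleRoot i)))
    where
    ring : ∀ x y → x + (y - x) ≡ y
    ring = solve-∀

  β′-bounded : (∀ k → lookup β k ℤ.≤ 1ℤ) → ∀ k → lookup β′ k ℤ.≤ 1ℤ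
  β′-bounded bound k = ℤ.≤-trans (ℤ.≤-reflexive (lookup-β′ k))
    (ℤ.≤-trans (ℤ.+-monoʳ-≤ (lookup β k) (ℤ.neg-mono-≤ (nonneg (simpleRoot-pos i) k)))
      (ℤ.≤-trans (ℤ.≤-reflexive (ℤ.+-identityʳ (lookup β k))) (bound k)))

norm-⊕ : (a b : Q n) → ⟨ a ⊕ b , a ⊕ b ⟩ ≡ ⟨ a , a ⟩ + + 2 * ⟨ a , b ⟩ + ⟨ b , b ⟩
norm-⊕ a b = trans (cong (λ x → ⟨ x , x ⟩) (⊕-lin a b)) (trans (norm-lin 1ℤ a b) (ring ⟨ a , a ⟩ ⟨ a , b ⟩ ⟨ b , b ⟩))
  where
  ring : ∀ x y z → 1ℤ * 1ℤ * x + + 2 * 1ℤ * y + z ≡ x + + 2 * y + z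
  ring = solve-∀

norm-⊖ : (a b : Q n) → ⟨ a ⊖ b , a ⊖ b ⟩ ≡ ⟨ a , a ⟩ - + 2 * ⟨ a , b ⟩ + ⟨ b , b ⟩
norm-⊖ a b = trans (cong (λ x → ⟨ x , x ⟩) (⊖-lin a b)) (trans (norm-lin -1ℤ b a)
  (trans (cong (λ z → -1ℤ * -1ℤ * ⟨ b , b ⟩ + + 2 * -1ℤ * z + ⟨ a , a ⟩) (⟨⟩-sym b a)) (ring ⟨ a , a ⟩ ⟨ a , b ⟩ ⟨ b , b ⟩)))
  where
  ring : ∀ x y z → -1ℤ * -1ℤ * z + + 2 * -1ℤ * y + x ≡ x - + 2 * y + z
  ring = solve-∀

-- The number is 4 - 2p for p = 3 + k: the norm that β - αᵢ would have if its two terms paired to p,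
-- and likewise β + γ for pairing -p.
0≰-[2+2k] : ∀ k → ¬ 0ℤ ℤ.≤ - (+ 2 + + 2 * + k)
0≰-[2+2k] k = ℤ.<⇒≱ (ℤ.neg-mono-< {0ℤ} {+ 2 + + 2 * + k}
  (ℤ.+-mono-<-≤ {0ℤ} {+ 2} {0ℤ} (ℤ.+<+ (s≤s z≤n)) (*-nonneg-nonneg {+ 2} {+ k} (ℤ.+≤+ z≤n) (ℤ.+≤+ z≤n))))

-- Meant for involutions u, where u ∘ t ∘ u is the conjugate of t. `Reflection` is phrased by words,
-- so closure under conjugation by `s β` is built up along the peeling of β; it later moves a
-- reflection past a factor of a product.
ClosedUnderConjBy : (Q n → Q n) → Set
ClosedUnderConjBy u = ∀ {t} → t ∈ Reflection → u ∘ t ∘ u ∈ Reflection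

closed-conj : {a b u : Q n → Q n} → ClosedUnderConjBy a → ClosedUnderConjBy b → u ≗ a ∘ b ∘ a → ClosedUnderConjBy u
closed-conj {a = a} {b} {u} a-closed b-closed u≗ {t} t∈ = Reflection-resp
  (λ μ → sym (trans (u≗ (t (u μ))) (cong (a ∘ b ∘ a ∘ t) (u≗ μ))))
  (a-closed (b-closed (a-closed t∈)))

ht≡1+ : {β : Q n} → Root β → Pos β → ∃ λ h → ht β ≡ + suc h
ht≡1+ {β = β} β-root β≥0 = go (ht β) refl
  where
  go : ∀ x → ht β ≡ x → ∃ λ h → ht β ≡ + suc h
  go (+ suc h) e = h , e
  go (+ zero)  e = ⊥-elim (let (i , βᵢ≢0) = root-≢0 β-root in βᵢ≢0 (sum-≥0-≡0 (lookup β) (nonneg β≥0) e i))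
  go -[1+ h ]  e = ⊥-elim (¬0≤ (subst (0ℤ ℤ.≤_) e (sum-≥0 (lookup β) (nonneg β≥0))))
    where
    ¬0≤ : ¬ 0ℤ ℤ.≤ -[1+ h ]
    ¬0≤ ()

peel-ht : ∀ {x y k} → x ≡ 1ℤ + y → x ≡ 1ℤ + k → y ≡ k
peel-ht {y = y} {k} e e′ = ℤ-Group.∙-cancelˡ 1ℤ y k (trans (sym e) e′)

+suc≢0 : ∀ {k x} → x ≡ + suc k → x ≢ 0ℤ
+suc≢0 refl ()

module _ (3≤n : 3 ℕ.≤ n) where

  -- ⟨β,β⟩ = Σ βᵢ⟨β,αᵢ⟩ has a positive term; then βᵢ = 1, and ⟨β,αᵢ⟩ ≤ 2 with
  -- equality only for β = αᵢ by semidefiniteness.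
  simple-or-peel : {β : Q n} → SmallRoot β → ∃ λ i →
    β ≡ simpleRoot i ⊎ (lookup β i ≡ 1ℤ × ⟨ β , simpleRoot i ⟩ ≡ 1ℤ)
  simple-or-peel {β} β-small = choose (sum>0⇒∃>0 _ (subst (0ℤ ℤ.<_) (trans (sym (norm≡2 isRoot)) (⟨⟩-expand β β)) (ℤ.+<+ (s≤s z≤n))))
    where
    open SmallRoot β-small
    one : ∀ {x} p → 0ℤ ℤ.≤ x → x ℤ.≤ 1ℤ → 0ℤ ℤ.< x * p → x ≡ 1ℤ
    one {+ 0} p _ _ (ℤ.+<+ ())
    one {+ 1} p _ _ _ = refl
    one {+ suc (suc k)} p _ (ℤ.+≤+ (s≤s ())) _
    choose : (∃ λ i → 0ℤ ℤ.< lookup β i * ⟨ β , simpleRoot i ⟩) → ∃ λ i →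
      β ≡ simpleRoot i ⊎ (lookup β i ≡ 1ℤ × ⟨ β , simpleRoot i ⟩ ≡ 1ℤ)
    choose (i , 0<prod) = i , cases ⟨ β , simpleRoot i ⟩ refl
      where
      α = simpleRoot i
      βᵢ≡1 : lookup β i ≡ 1ℤ
      βᵢ≡1 = one ⟨ β , α ⟩ (nonneg isPos i) (bounded i) 0<prod
      0<⟨β,α⟩ : 0ℤ ℤ.< ⟨ β , α ⟩
      0<⟨β,α⟩ = subst (0ℤ ℤ.<_) (trans (cong (_* ⟨ β , α ⟩) βᵢ≡1) (ℤ.*-identityˡ ⟨ β , α ⟩)) 0<prod
      norm : ∀ p → ⟨ β , α ⟩ ≡ p → ⟨ β ⊖ α , β ⊖ α ⟩ ≡ + 2 - + 2 * p + + 2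
      norm p e = trans (norm-⊖ β α) (cong₂ _+_ (cong₂ (λ x y → x - + 2 * y) (norm≡2 isRoot) e) (norm≡2 (simpleRoot-root i)))
      cases : ∀ p → ⟨ β , α ⟩ ≡ p → β ≡ α ⊎ (lookup β i ≡ 1ℤ × ⟨ β , α ⟩ ≡ 1ℤ)
      cases (+ 1) e = inj₂ (βᵢ≡1 , e)
      cases (+ 2) e = inj₁ (lookup-inj λ k → ℤ.i-j≡0⇒i≡j (lookup β k) (lookup α k) (trans (sym (lookup-⊖ β α k))
        (trans (norm-≡0⇒constant 3≤n (β ⊖ α) (norm (+ 2) e) k i) (trans (lookup-⊖ β α i) (cong₂ _-_ βᵢ≡1 (simpleRoot-self i))))))
      cases (+ 0) e = ⊥-elim (ℤ.<-irrefl (sym e) 0<⟨β,α⟩)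
      cases -[1+ k ] e = ⊥-elim (¬0< (subst (0ℤ ℤ.<_) e 0<⟨β,α⟩))
        where
        ¬0< : ¬ 0ℤ ℤ.< -[1+ k ]
        ¬0< ()
      cases (+ suc (suc (suc k))) e = ⊥-elim (0≰-[2+2k] k
        (subst (0ℤ ℤ.≤_) (trans (norm _ e) (ring (+ k))) (norm-≥0 3≤n (β ⊖ α))))
        where
        ring : ∀ x → + 2 - + 2 * (+ 3 + x) + + 2 ≡ - (+ 2 + + 2 * x)
        ring = solve-∀

  -- Here h stands for ht β - 1, so the length suc (h + h) is 2·ht β - 1; each peeled simple root
  -- accounts for two letters.
  Reduced : Q n → ℕ → Set
  Reduced β h = Size (s β) (suc (h ℕ.+ h)) × s β ∈ Reflection × ClosedUnderConjBy (s β)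

  simpleRoot-reduced : ∀ i → Reduced (simpleRoot i) 0
  simpleRoot-reduced i = (([ i ] , (λ _ → refl) , refl) , simpleRoot-inversions i) , Reflection-simple i , Reflection-conj-simple i

  module _ (i : Fin n) {β : Q n} (β-small : SmallRoot β)
           (βᵢ≡1 : lookup β i ≡ 1ℤ) (⟨β,α⟩≡1 : ⟨ β , simpleRoot i ⟩ ≡ 1ℤ) where

    open SmallRoot β-small
    private module P = Peel 3≤n i β isRoot isPos βᵢ≡1 ⟨β,α⟩≡1

    peel-small : SmallRoot (s (simpleRoot i) β)
    peel-small = record { isRoot = P.β′-root ; isPos = P.β′-pos ; bounded = P.β′-bounded bounded }

    peel-reduced : ∀ h → Reduced (s (simpleRoot i) β) h → Reduced β (suc h)
    peel-reduced h (size , refl-β′ , closed) =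
      subst (λ k → Size (s β) (2 ℕ.+ k)) (sym (ℕ.+-suc h h)) (P.size-extend size) ,
      P.reflection-extend refl-β′ ,
      closed-conj {a = s (simpleRoot i)} {b = s (s (simpleRoot i) β)} (Reflection-conj-simple i) closed P.conj

    ht-peel : ∀ {k} → ht β ≡ 1ℤ + k → ht (s (simpleRoot i) β) ≡ k
    ht-peel = peel-ht P.ht-β′

  smallRoot-reduced : ∀ h {β : Q n} → SmallRoot β → ht β ≡ + suc h → Reduced β h
  smallRoot-reduced h {β} β-small ht≡ = let (i , alt) = simple-or-peel β-small in [ simple i , peel i h ht≡ ]′ alt
    where
    open SmallRoot β-small
    simple : ∀ i → β ≡ simpleRoot i → Reduced β h
    simple i β≡ = subst₂ Reduced (sym β≡)
      (ℕ.suc-injective (ℤ.+-injective (trans (sym (ht-simpleRoot i)) (trans (cong ht (sym β≡)) ht≡))))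
      (simpleRoot-reduced i)
    peel : ∀ i h → ht β ≡ + suc h → lookup β i ≡ 1ℤ × ⟨ β , simpleRoot i ⟩ ≡ 1ℤ → Reduced β h
    -- At height 1, peeling would leave a positive root of height 0.
    peel i zero ht≡ (βᵢ≡1 , ⟨β,α⟩≡1) = ⊥-elim (+suc≢0
      (proj₂ (ht≡1+ (SmallRoot.isRoot β′-small) (SmallRoot.isPos β′-small)))
      (ht-peel i β-small βᵢ≡1 ⟨β,α⟩≡1 ht≡))
      where β′-small = peel-small i β-small βᵢ≡1 ⟨β,α⟩≡1
    peel i (suc h) ht≡ (βᵢ≡1 , ⟨β,α⟩≡1) = peel-reduced i β-small βᵢ≡1 ⟨β,α⟩≡1 h
      (smallRoot-reduced h (peel-small i β-small βᵢ≡1 ⟨β,α⟩≡1) (ht-peel i β-small βᵢ≡1 ⟨β,α⟩≡1 ht≡))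

-- Products of reflections in disjoint roots

-- The head acts first: putting a root in front multiplies on the right, as following an edge does.
prod : List (Q n) → Q n → Q n
prod []      = id
prod (β ∷ L) = prod L ∘ s β

total : List (Q n) → Q n
total []      = 𝟎
total (β ∷ L) = β ⊕ total L

-- Nonnegative vectors with total at most 1 everywhere have disjoint supports, and the gap keeps a
-- sum of two entries from being constant. Both conditions depend on the total alone, so they
-- survive every move that preserves it.
record Valid (L : List (Q n)) : Set where
  field
    roots   : All SmallRoot L
    total≤1 : ∀ i → lookup (total L) i ℤ.≤ 1ℤ
    gap     : ∃ λ i → lookup (total L) i ≡ 0ℤ

total-pos : {L : List (Q n)} → All SmallRoot L → Pos (total L)
total-pos [] = nonnegative λ i → ℤ.≤-reflexive (sym (lookup-𝟎 i))
total-pos {L = β ∷ L} (β-small ∷ roots) = nonnegative λ i → subst (0ℤ ℤ.≤_) (sym (lookup-⊕ β (total L) i))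
  (ℤ.+-mono-≤ (nonneg (SmallRoot.isPos β-small) i) (nonneg (total-pos roots) i))

total-∷-≡0 : {β : Q n} {L : List (Q n)} → All SmallRoot (β ∷ L) → ∀ i → lookup (total (β ∷ L)) i ≡ 0ℤ →
  lookup β i ≡ 0ℤ × lookup (total L) i ≡ 0ℤ
total-∷-≡0 {β = β} {L} (β-small ∷ roots) i e =
  +≡0⇒≡0 (nonneg (SmallRoot.isPos β-small) i) (nonneg (total-pos roots) i) (trans (sym (lookup-⊕ β (total L) i)) e)

valid-tail : {β : Q n} {L : List (Q n)} → Valid (β ∷ L) → Valid L
valid-tail {β = β} {L} valid = record
  { roots   = All.tail roots
  ; total≤1 = λ i → ℤ.≤-trans (ℤ.≤-trans (ℤ.≤-reflexive (sym (ℤ.+-identityˡ (lookup (total L) i))))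
      (ℤ.+-monoˡ-≤ (lookup (total L) i) (nonneg (SmallRoot.isPos (All.head roots)) i)))
      (subst (ℤ._≤ 1ℤ) (lookup-⊕ β (total L) i) (total≤1 i))
  ; gap     = proj₁ gap , proj₂ (total-∷-≡0 roots (proj₁ gap) (proj₂ gap))
  }
  where open Valid valid

+≤1⇒≡0 : ∀ {x y} → 0ℤ ℤ.≤ x → 0ℤ ℤ.≤ y → x + y ℤ.≤ 1ℤ → y ≡ 0ℤ ⊎ x ≡ 0ℤ
+≤1⇒≡0 {+ zero} _ _ _ = inj₂ refl
+≤1⇒≡0 {+ suc x} {+ zero} _ _ _ = inj₁ refl
+≤1⇒≡0 {+ suc x} {+ suc y} _ _ (ℤ.+≤+ (s≤s le)) = ⊥-elim (ℕ.m+1+n≢0 x (ℕ.n≤0⇒n≡0 le))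

valid-disjoint : {β : Q n} {L : List (Q n)} → Valid (β ∷ L) → Disjoint (total L) β
valid-disjoint {β = β} {L} valid i =
  +≤1⇒≡0 (nonneg (SmallRoot.isPos (All.head roots)) i) (nonneg (total-pos (All.tail roots)) i)
    (subst (ℤ._≤ 1ℤ) (lookup-⊕ β (total L) i) (total≤1 i))
  where open Valid valid

prod-fixes : {L : List (Q n)} → All SmallRoot L → Fixes (total L) (prod L)
prod-fixes [] = fixes λ μ i _ → refl
prod-fixes {L = β ∷ L} all@(_ ∷ roots) = fixes λ μ i e → let (β≡0 , t≡0) = total-∷-≡0 all i e in
  trans (fixed (prod-fixes roots) (s β μ) i t≡0) (fixed (s-fixes β) μ i β≡0)

prod-root : {L : List (Q n)} → All SmallRoot L → ∀ {r} → Root r → Root (prod L r)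
prod-root [] r-root = r-root
prod-root (β-small ∷ roots) r-root = prod-root roots (s-root (SmallRoot.isRoot β-small) r-root)

ht-𝟎 : ∀ n → ht (𝟎 {n}) ≡ 0ℤ
ht-𝟎 n = sum-zero {n} lookup-𝟎

Size⇒W : {u : Q n → Q n} {k : ℕ} → Size u k → u ∈ W
Size⇒W ((w , eq , _) , _) = w , eq

ListSize : List (Q n) → ℕ → Set
ListSize L k = Size (prod L) k × + k + + length L ≡ ht (total L) + ht (total L)

module _ (3≤n : 3 ℕ.≤ n) where

  Size⇒HasLength : {u : Q n → Q n} {k : ℕ} → Size u k → HasLength u k
  Size⇒HasLength (word , R , unique , invs , refl) = word , λ w eq →
    inversions-≤-length 3≤n w R unique (proj₁ (proj₂ (proj₂ (Inversions-resp eq (R , unique , invs , refl)))))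

  Size-⟶ : {u v t : Q n → Q n} {k l : ℕ} → t ∈ Reflection → v ≗ u ∘ t → Size u k → Size v l → k ℕ.< l → u ⟶ v
  Size-⟶ {t = t} {k} {l} t∈ eq size size′ k<l = (t , t∈ , eq) , k , l , Size⇒HasLength size , Size⇒HasLength size′ , k<l

  list-size : (L : List (Q n)) → Valid L → ∃ (ListSize L)
  list-size [] valid = 0 , (([] , (λ _ → refl) , refl) , [] , [] , [] , refl) , sym (cong₂ _+_ (ht-𝟎 n) (ht-𝟎 n))
  list-size (β ∷ L) valid = combine (ht≡1+ isRoot isPos) (list-size L (valid-tail valid))
    where
    open Valid valid
    open SmallRoot (All.head roots)
    combine : (∃ λ h → ht β ≡ + suc h) → ∃ (ListSize L) → ∃ (ListSize (β ∷ L))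
    combine (h , ht≡) (k , (word , invs) , eq) = k′ ℕ.+ k ,
      (subst (Word _) (ℕ.+-comm k k′) (Word-∘ word (proj₁ β-size)) ,
       inversions-∘ 3≤n (prod-fixes (All.tail roots)) (prod-root (All.tail roots)) isRoot (valid-disjoint valid) (proj₂ β-size) invs) ,
      trans (cong (_+ + suc (length L)) (ℤ.pos-+ k′ k)) (trans (ring₁ (+ k′) (+ k) (+ length L))
        (trans (cong₂ _+_ (cong (λ z → 1ℤ + (1ℤ + z)) (ℤ.pos-+ h h)) eq) (trans (ring₂ (+ h) (ht (total L)))
          (sym (cong₂ _+_ ht′ ht′)))))
      where
      k′ = suc (h ℕ.+ h)
      β-size : Size (s β) k′
      β-size = proj₁ (smallRoot-reduced 3≤n h (All.head roots) ht≡)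
      ht′ : ht (β ⊕ total L) ≡ (1ℤ + + h) + ht (total L)
      ht′ = trans (ht-⊕ β (total L)) (cong (_+ ht (total L)) ht≡)
      ring₁ : ∀ x y z → x + y + (1ℤ + z) ≡ (1ℤ + x) + (y + z)
      ring₁ = solve-∀
      ring₂ : ∀ h t → 1ℤ + (1ℤ + (h + h)) + (t + t) ≡ (1ℤ + h) + t + ((1ℤ + h) + t)
      ring₂ = solve-∀

-- Merging factors into an orthogonal list

record Merge (L L′ : List (Q n)) : Set where
  field
    {t}          : Q n → Q n
    isReflection : t ∈ Reflection
    prod-∘       : prod L′ ≗ prod L ∘ t
    total≡       : total L ≡ total L′
    length≡      : length L ≡ suc (length L′)

infix 4 _⊑_

-- Moves are recorded on lists, without lengths, so that `⊑-∷` can carry them under a common head;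
-- `⊑⇒≤ᴮ` supplies the lengths afterwards. `same` accommodates swaps of commuting factors, which
-- leave the product as it is.
data _⊑_ {n} (L : List (Q n)) : List (Q n) → Set where
  same  : ∀ {N} → prod L ≗ prod N → total L ≡ total N → length L ≡ length N → L ⊑ N
  merge : ∀ {L′ N} → Merge L L′ → All SmallRoot L′ → L′ ⊑ N → L ⊑ N

⊑-refl : {L : List (Q n)} → L ⊑ L
⊑-refl = same (λ _ → refl) refl refl

⊑-trans : {L M N : List (Q n)} → L ⊑ M → M ⊑ N → L ⊑ N
⊑-trans (merge m roots L′⊑M) M⊑N = merge m roots (⊑-trans L′⊑M M⊑N)
⊑-trans (same eq tot len) (same eq′ tot′ len′) =
  same (λ μ → trans (eq μ) (eq′ μ)) (trans tot tot′) (trans len len′)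
⊑-trans (same eq tot len) (merge m roots M′⊑N) = merge record
  { isReflection = isReflection
  ; prod-∘       = λ μ → trans (prod-∘ μ) (sym (eq (t μ)))
  ; total≡       = trans tot total≡
  ; length≡      = trans len length≡
  } roots M′⊑N
  where open Merge m

⊑-total : {L N : List (Q n)} → L ⊑ N → total L ≡ total N
⊑-total (same _ tot _)      = tot
⊑-total (merge m _ L′⊑N) = trans (Merge.total≡ m) (⊑-total L′⊑N)

record Perp (β γ : Q n) : Set where
  constructor perp
  field
    pairing≡0 : ⟨ β , γ ⟩ ≡ 0ℤ

open Perp

Perp-sym : {β γ : Q n} → Perp β γ → Perp γ β
Perp-sym {β = β} {γ} (perp e) = perp (trans (⟨⟩-sym γ β) e)

Perp-⊕ : {δ β γ : Q n} → Perp δ β → Perp δ γ → Perp δ (β ⊕ γ)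
Perp-⊕ {δ = δ} {β} {γ} (perp e) (perp e′) = perp (trans (⟨⟩-⊕ʳ β γ δ) (cong₂ _+_ e e′))

⊕-assoc : (a b d : Q n) → (a ⊕ b) ⊕ d ≡ a ⊕ (b ⊕ d)
⊕-assoc = zipWith-assoc ℤ.+-assoc

⊕-swap : (a b d : Q n) → a ⊕ (b ⊕ d) ≡ b ⊕ (a ⊕ d)
⊕-swap a b d = trans (sym (⊕-assoc a b d)) (trans (cong (_⊕ d) (zipWith-comm ℤ.+-comm a b)) (⊕-assoc b a d))

s-pairing-1 : (β γ : Q n) → ⟨ β , γ ⟩ ≡ -1ℤ → s γ β ≡ β ⊕ γ
s-pairing-1 β γ e = lookup-inj λ k → trans (lookup-s γ β k) (trans (cong (λ z → lookup β k - z * lookup γ k) e)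
  (trans (ring (lookup β k) (lookup γ k)) (sym (lookup-⊕ β γ k))))
  where
  ring : ∀ x y → x - -1ℤ * y ≡ x + y
  ring = solve-∀

s-perp : (β γ : Q n) → Perp β γ → s γ β ≡ β
s-perp β γ (perp e) = lookup-inj λ k → trans (lookup-s γ β k) (trans (cong (λ z → lookup β k - z * lookup γ k) e)
  (ring (lookup β k) (lookup γ k)))
  where
  ring : ∀ x y → x - 0ℤ * y ≡ x
  ring = solve-∀

s-comm : {β γ : Q n} → Root γ → Perp β γ → ∀ μ → s γ (s β μ) ≡ s β (s γ μ)
s-comm {β = β} {γ} γ-root β⊥γ μ = sym (begin
  s β (s γ μ)             ≡⟨ cong (λ b → s b (s γ μ)) (s-perp β γ β⊥γ) ⟨
  s (s γ β) (s γ μ)       ≡⟨ s-conj γ-root β (s γ μ) ⟩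
  s γ (s β (s γ (s γ μ))) ≡⟨ cong (λ ν → s γ (s β ν)) (s-involutive γ-root μ) ⟩
  s γ (s β μ)             ∎)
  where open ≡-Reasoning

valid-resp : {L L′ : List (Q n)} → total L ≡ total L′ → All SmallRoot L′ → Valid L → Valid L′
valid-resp tot roots valid = record
  { roots   = roots
  ; total≤1 = λ i → subst (λ a → lookup a i ℤ.≤ 1ℤ) tot (Valid.total≤1 valid i)
  ; gap     = proj₁ (Valid.gap valid) , subst (λ a → lookup a (proj₁ (Valid.gap valid)) ≡ 0ℤ) tot (proj₂ (Valid.gap valid))
  }

Orthogonal : List (Q n) → Set
Orthogonal = AllPairs Perp

⊕-small : {β γ : Q n} {M : List (Q n)} → Valid (β ∷ γ ∷ M) → ⟨ β , γ ⟩ ≡ -1ℤ → SmallRoot (β ⊕ γ)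
⊕-small {β = β} {γ = γ} {M = M} valid e = record
  { isRoot  = root (trans (norm-⊕ β γ) (cong₂ _+_ (cong₂ (λ x y → x + + 2 * y) (norm≡2 β.isRoot) e) (norm≡2 γ.isRoot)))
  ; isPos   = nonnegative λ i → subst (0ℤ ℤ.≤_) (sym (lookup-⊕ β γ i)) (ℤ.+-mono-≤ (nonneg β.isPos i) (nonneg γ.isPos i))
  ; bounded = λ i → ℤ.≤-trans (ℤ.≤-reflexive (sym (ℤ.+-identityʳ (lookup (β ⊕ γ) i))))
      (ℤ.≤-trans (ℤ.+-monoʳ-≤ (lookup (β ⊕ γ) i) (nonneg (total-pos (All.tail (All.tail roots))) i))
        (ℤ.≤-trans (ℤ.≤-reflexive (trans (sym (lookup-⊕ (β ⊕ γ) (total M) i)) (cong (λ a → lookup a i) (⊕-assoc β γ (total M))))) (total≤1 i)))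
  }
  where
  open Valid valid
  module β = SmallRoot (All.head roots)
  module γ = SmallRoot (All.head (All.tail roots))

-- Since β + γ = s_γ(β), its reflection is s_γ s_β s_γ: the old factors s_γ s_β with a further s_γ
-- on the right.
merge-adjacent : {β γ : Q n} {M : List (Q n)} → Root γ → ⟨ β , γ ⟩ ≡ -1ℤ → s γ ∈ Reflection → Merge (β ∷ γ ∷ M) (β ⊕ γ ∷ M)
merge-adjacent {β = β} {γ = γ} {M = M} γ-root e γ-refl = record
  { t            = s γ
  ; isReflection = γ-refl
  ; prod-∘       = λ μ → cong (prod M) (trans (cong (λ b → s b μ) (sym (s-pairing-1 β γ e))) (s-conj γ-root β μ))
  ; total≡       = sym (⊕-assoc β γ (total M))
  ; length≡      = refl
  }

swap-perp : {β γ : Q n} {M : List (Q n)} → Root γ → Perp β γ → (β ∷ γ ∷ M) ⊑ (γ ∷ β ∷ M)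
swap-perp {β = β} {γ = γ} {M = M} γ-root β⊥γ = same (λ μ → cong (prod M) (s-comm γ-root β⊥γ μ)) (⊕-swap β γ (total M)) refl

module _ (3≤n : 3 ℕ.≤ n) where

  conj-closed : {β : Q n} → SmallRoot β → ClosedUnderConjBy (s β)
  conj-closed β-small = let (h , ht≡) = ht≡1+ (SmallRoot.isRoot β-small) (SmallRoot.isPos β-small)
    in proj₂ (proj₂ (smallRoot-reduced 3≤n h β-small ht≡))

  smallRoot-reflection : {β : Q n} → SmallRoot β → s β ∈ Reflection
  smallRoot-reflection β-small = let (h , ht≡) = ht≡1+ (SmallRoot.isRoot β-small) (SmallRoot.isPos β-small)
    in proj₁ (proj₂ (smallRoot-reduced 3≤n h β-small ht≡))

  ⊑-∷ : {δ : Q n} {L N : List (Q n)} → SmallRoot δ → L ⊑ N → (δ ∷ L) ⊑ (δ ∷ N)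
  ⊑-∷ {δ} δ-small (same eq tot len) = same (λ μ → eq (s δ μ)) (cong (δ ⊕_) tot) (cong suc len)
  ⊑-∷ {δ} {L} δ-small (merge {L′} m roots L′⊑N) = merge record
    { t            = s δ ∘ t ∘ s δ
    -- t stood directly to the right of `prod L`; the factor `s δ` comes between them, and t passes
    -- it by conjugation.
    ; isReflection = conj-closed δ-small isReflection
    ; prod-∘       = λ μ → trans (prod-∘ (s δ μ)) (cong (prod L) (sym (s-involutive (SmallRoot.isRoot δ-small) (t (s δ μ)))))
    ; total≡       = cong (δ ⊕_) total≡
    ; length≡      = cong suc length≡
    } (δ-small ∷ roots) (⊑-∷ δ-small L′⊑N)
    where open Merge m

  -- The value −2 would make the norm of β ⊕ γ vanish, hence β ⊕ γ constant.
  valid-pairing : {β γ : Q n} {M : List (Q n)} → Valid (β ∷ γ ∷ M) → Perp β γ ⊎ ⟨ β , γ ⟩ ≡ -1ℤ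
  valid-pairing {β} {γ} {M} valid = cases ⟨ β , γ ⟩ refl
    where
    open Valid valid
    module β = SmallRoot (All.head roots)
    module γ = SmallRoot (All.head (All.tail roots))
    norm : ∀ p → ⟨ β , γ ⟩ ≡ p → ⟨ β ⊕ γ , β ⊕ γ ⟩ ≡ + 2 + + 2 * p + + 2
    norm p e = trans (norm-⊕ β γ) (cong₂ _+_ (cong₂ (λ x y → x + + 2 * y) (norm≡2 β.isRoot) e) (norm≡2 γ.isRoot))
    disjoint : Disjoint β γ
    disjoint i = [ (λ e → inj₂ (proj₁ (total-∷-≡0 (All.tail roots) i e))) , inj₁ ]′ (valid-disjoint valid i)
    ≤0 : ⟨ β , γ ⟩ ℤ.≤ 0ℤ
    ≤0 = disjoint-≤0 β γ β.isPos γ.isPos disjoint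
    sum-gap : lookup (β ⊕ γ) (proj₁ gap) ≡ 0ℤ
    sum-gap = let (β≡0 , rest≡0) = total-∷-≡0 roots (proj₁ gap) (proj₂ gap)
                  (γ≡0 , _) = total-∷-≡0 (All.tail roots) (proj₁ gap) rest≡0
              in trans (lookup-⊕ β γ (proj₁ gap)) (cong₂ _+_ β≡0 γ≡0)
    not-constant : ⟨ β ⊕ γ , β ⊕ γ ⟩ ≢ 0ℤ
    not-constant e = let (k , βₖ≢0) = root-≢0 β.isRoot in βₖ≢0 (proj₁ (+≡0⇒≡0 (nonneg β.isPos k) (nonneg γ.isPos k)
      (trans (sym (lookup-⊕ β γ k)) (trans (norm-≡0⇒constant 3≤n (β ⊕ γ) e k (proj₁ gap)) sum-gap))))
    cases : ∀ p → ⟨ β , γ ⟩ ≡ p → Perp β γ ⊎ ⟨ β , γ ⟩ ≡ -1ℤ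
    cases (+ zero)  e = inj₁ (perp e)
    cases (+ suc k) e = ⊥-elim (¬≤0 (subst (ℤ._≤ 0ℤ) e ≤0))
      where
      ¬≤0 : ¬ + suc k ℤ.≤ 0ℤ
      ¬≤0 (ℤ.+≤+ ())
    cases -[1+ 0 ] e = inj₂ e
    cases -[1+ 1 ] e = ⊥-elim (not-constant (norm -[1+ 1 ] e))
    cases -[1+ suc (suc k) ] e = ⊥-elim (0≰-[2+2k] k
      (subst (0ℤ ℤ.≤_) (trans (norm _ e) (ring (+ k))) (norm-≥0 3≤n (β ⊕ γ))))
      where
      ring : ∀ x → + 2 + + 2 * - (+ 3 + x) + + 2 ≡ - (+ 2 + + 2 * x)
      ring = solve-∀

  -- `keeps-perp` is the invariant of the recursion: a factor that β has passed must stay orthogonal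
  -- to everything β is later merged into.
  record Absorbed (β : Q n) (M : List (Q n)) : Set where
    field
      {N}        : List (Q n)
      ⊑N         : (β ∷ M) ⊑ N
      orthogonal : Orthogonal N
      roots      : All SmallRoot N
      keeps-perp : ∀ {δ} → Perp δ β → All (Perp δ) M → All (Perp δ) N

  -- β travels through M: it commutes past an orthogonal factor and swallows one with pairing -1,
  -- continuing as their sum. Either way the list still ahead is shorter, so the recursion is on M.
  absorb : (β : Q n) (M : List (Q n)) → Valid (β ∷ M) → Orthogonal M → Absorbed β M
  absorb β [] valid _ = record
    { ⊑N = ⊑-refl ; orthogonal = [] ∷ [] ; roots = Valid.roots valid ; keeps-perp = λ δ⊥β _ → δ⊥β ∷ [] }
  absorb β (γ ∷ M) valid (γ⊥M ∷ M-orth) = [ perpendicular , adjacent ]′ (valid-pairing valid)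
    where
    open Valid valid
    γ-small : SmallRoot γ
    γ-small = All.head (All.tail roots)
    γ-root : Root γ
    γ-root = SmallRoot.isRoot γ-small
    perpendicular : Perp β γ → Absorbed β (γ ∷ M)
    perpendicular β⊥γ = record
      { ⊑N         = ⊑-trans (swap-perp γ-root β⊥γ) (⊑-∷ γ-small IH.⊑N)
      ; orthogonal = IH.keeps-perp (Perp-sym β⊥γ) γ⊥M ∷ IH.orthogonal
      ; roots      = γ-small ∷ IH.roots
      ; keeps-perp = λ { δ⊥β (δ⊥γ ∷ δ⊥M) → δ⊥γ ∷ IH.keeps-perp δ⊥β δ⊥M }
      }
      where
      swapped : Valid (γ ∷ β ∷ M)
      swapped = valid-resp (⊕-swap β γ (total M)) (γ-small ∷ All.head roots ∷ All.tail (All.tail roots)) valid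
      module IH = Absorbed (absorb β M (valid-tail swapped) M-orth)
    adjacent : ⟨ β , γ ⟩ ≡ -1ℤ → Absorbed β (γ ∷ M)
    adjacent e = record
      { ⊑N         = merge (merge-adjacent γ-root e (smallRoot-reflection γ-small)) roots′ IH.⊑N
      ; orthogonal = IH.orthogonal
      ; roots      = IH.roots
      ; keeps-perp = λ { δ⊥β (δ⊥γ ∷ δ⊥M) → IH.keeps-perp (Perp-⊕ δ⊥β δ⊥γ) δ⊥M }
      }
      where
      roots′ : All SmallRoot (β ⊕ γ ∷ M)
      roots′ = ⊕-small valid e ∷ All.tail (All.tail roots)
      module IH = Absorbed (absorb (β ⊕ γ) M (valid-resp (sym (⊕-assoc β γ (total M))) roots′ valid) M-orth)

  normalise : (L : List (Q n)) → Valid L → ∃ λ N → L ⊑ N × Orthogonal N × All SmallRoot N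
  normalise [] _ = [] , ⊑-refl , [] , []
  normalise (β ∷ L) valid with normalise L (valid-tail valid)
  ... | M , L⊑M , M-orth , M-roots = Abs.N , ⊑-trans (⊑-∷ β-small L⊑M) Abs.⊑N , Abs.orthogonal , Abs.roots
    where
    β-small : SmallRoot β
    β-small = All.head (Valid.roots valid)
    module Abs = Absorbed (absorb β M (valid-resp (cong (β ⊕_) (⊑-total L⊑M)) (β-small ∷ M-roots) valid) M-orth)

-- The positive real roots

lookup-interval-∈ : {i j k : Fin n} → i Fin.≤ k → k Fin.≤ j → lookup (interval i j) k ≡ 1ℤ
lookup-interval-∈ {i = i} {j} {k} i≤k k≤j = trans (lookup∘tabulate _ k) compute
  where
  compute : (if ⌊ i Fin.≤? k ⌋ ∧ ⌊ k Fin.≤? j ⌋ then 1ℤ else 0ℤ) ≡ 1ℤ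
  compute with i Fin.≤? k | k Fin.≤? j
  ... | yes _  | yes _  = refl
  ... | yes _  | no k≰j = ⊥-elim (k≰j k≤j)
  ... | no i≰k | _      = ⊥-elim (i≰k i≤k)

lookup-interval-∉ : {i j k : Fin n} → (i Fin.≤ k → ¬ k Fin.≤ j) → lookup (interval i j) k ≡ 0ℤ
lookup-interval-∉ {i = i} {j} {k} k∉ = trans (lookup∘tabulate _ k) compute
  where
  compute : (if ⌊ i Fin.≤? k ⌋ ∧ ⌊ k Fin.≤? j ⌋ then 1ℤ else 0ℤ) ≡ 0ℤ
  compute with i Fin.≤? k | k Fin.≤? j
  ... | yes i≤k | yes k≤j = ⊥-elim (k∉ i≤k k≤j)
  ... | yes _   | no _    = refl
  ... | no _    | _       = refl

interval-0/1 : (i j k : Fin n) → lookup (interval i j) k ≡ 0ℤ ⊎ lookup (interval i j) k ≡ 1ℤ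
interval-0/1 i j k with i Fin.≤? k | k Fin.≤? j
... | yes i≤k | yes k≤j = inj₂ (lookup-interval-∈ i≤k k≤j)
... | yes _   | no k≰j  = inj₁ (lookup-interval-∉ {i = i} {j} {k} λ _ → k≰j)
... | no i≰k  | _       = inj₁ (lookup-interval-∉ {i = i} {j} {k} λ i≤k → ⊥-elim (i≰k i≤k))

interval-pos : (i j : Fin n) → Pos (interval i j)
interval-pos i j = nonnegative λ k →
  [ (λ e → ℤ.≤-reflexive (sym e)) , (λ e → subst (0ℤ ℤ.≤_) (sym e) (ℤ.+≤+ z≤n)) ]′ (interval-0/1 i j k)

interval-≤1 : (i j k : Fin n) → lookup (interval i j) k ℤ.≤ 1ℤ
interval-≤1 i j k = [ (λ e → subst (ℤ._≤ 1ℤ) (sym e) (ℤ.+≤+ z≤n)) , ℤ.≤-reflexive ]′ (interval-0/1 i j k)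

-- The coordinates of the interval jump at its two ends only.
interval-jump : (i j : Fin n) → 1 ℕ.≤ toℕ i → i Fin.≤ j → ∀ k →
  (lookup (interval i j) k - lookup (interval i j) (next k)) * (lookup (interval i j) k - lookup (interval i j) (next k))
    ≡ δ j k + δ i (next k)
interval-jump {n} i j 1≤i i≤j k = [ inner , outer ]′ (toℕ-next⁻¹ k)
  where
  x : Fin n → ℤ
  x = lookup (interval i j)
  conclude : ∀ {a b p q} → x k ≡ a → x (next k) ≡ b → δ j k ≡ p → δ i (next k) ≡ q →
    (a - b) * (a - b) ≡ p + q → (x k - x (next k)) * (x k - x (next k)) ≡ δ j k + δ i (next k)
  conclude refl refl refl refl e = e
  ∉ : ∀ l → (i Fin.≤ l → ¬ l Fin.≤ j) → x l ≡ 0ℤ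
  ∉ l = lookup-interval-∉ {i = i} {j} {l}
  <⇒≢ : ∀ {l m : Fin n} → toℕ l ℕ.< toℕ m → l ≢ m
  <⇒≢ l<m refl = ℕ.<-irrefl refl l<m
  inner : toℕ (next k) ≡ suc (toℕ k) → (x k - x (next k)) * (x k - x (next k)) ≡ δ j k + δ i (next k)
  inner e with ℕ.<-cmp (suc (toℕ k)) (toℕ i)
  ... | tri< k+1<i _ _ = conclude
    (∉ k λ i≤k _ → ℕ.<⇒≱ (ℕ.<-trans (ℕ.n<1+n _) k+1<i) i≤k)
    (∉ (next k) λ i≤k′ _ → ℕ.<⇒≱ k+1<i (subst (toℕ i ℕ.≤_) e i≤k′))
    (δ-≢ {i = j} {k} λ { refl → ℕ.<⇒≱ (ℕ.<-trans (ℕ.n<1+n _) k+1<i) i≤j })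
    (δ-≢ {i = i} {next k} λ i≡ → ℕ.<⇒≢ k+1<i (trans (sym e) (cong toℕ (sym i≡)))) refl
  ... | tri≈ _ k+1≡i _ = conclude
    (∉ k λ i≤k _ → ℕ.<⇒≱ (ℕ.≤-reflexive k+1≡i) i≤k)
    (lookup-interval-∈ (ℕ.≤-reflexive (sym k′≡i)) (subst (ℕ._≤ toℕ j) (sym k′≡i) i≤j))
    (δ-≢ {i = j} {k} λ { refl → ℕ.<⇒≱ (ℕ.≤-reflexive k+1≡i) i≤j })
    (δ-≡ {i = i} {next k} (Fin.toℕ-injective (sym k′≡i))) refl
    where k′≡i = trans e k+1≡i
  ... | tri> _ _ i<k+1 with ℕ.<-cmp (toℕ k) (toℕ j)
  ...   | tri< k<j _ _ = conclude
    (lookup-interval-∈ (ℕ.≤-pred i<k+1) (ℕ.<⇒≤ k<j))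
    (lookup-interval-∈ (subst (toℕ i ℕ.≤_) (sym e) (ℕ.<⇒≤ i<k+1)) (subst (ℕ._≤ toℕ j) (sym e) k<j))
    (δ-≢ {i = j} {k} λ j≡k → <⇒≢ k<j (sym j≡k))
    (δ-≢ {i = i} {next k} (<⇒≢ (subst (toℕ i ℕ.<_) (sym e) i<k+1))) refl
  ...   | tri≈ _ k≡j _ = conclude
    (lookup-interval-∈ (ℕ.≤-pred i<k+1) (ℕ.≤-reflexive k≡j))
    (∉ (next k) λ _ k′≤j → ℕ.<⇒≱ (ℕ.≤-reflexive (cong suc (sym k≡j))) (subst (ℕ._≤ toℕ j) e k′≤j))
    (δ-≡ {i = j} {k} (Fin.toℕ-injective (sym k≡j)))
    (δ-≢ {i = i} {next k} (<⇒≢ (subst (toℕ i ℕ.<_) (sym e) i<k+1))) refl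
  ...   | tri> _ _ j<k = conclude
    (∉ k λ _ k≤j → ℕ.<⇒≱ j<k k≤j)
    (∉ (next k) λ _ k′≤j → ℕ.<⇒≱ (ℕ.<-trans j<k (ℕ.n<1+n _)) (subst (ℕ._≤ toℕ j) e k′≤j))
    (δ-≢ {i = j} {k} (<⇒≢ j<k))
    (δ-≢ {i = i} {next k} (<⇒≢ (subst (toℕ i ℕ.<_) (sym e) i<k+1))) refl
  -- This is the edge from the last vertex back to 0. As 1 ≤ i, vertex 0 lies outside the interval,
  -- so only the end j can cause a jump here.
  outer : suc (toℕ k) ≡ n × toℕ (next k) ≡ 0 → (x k - x (next k)) * (x k - x (next k)) ≡ δ j k + δ i (next k)
  outer (k+1≡n , e) = [ ends-last , ends-before ]′ (toSum (j Fin.≟ k))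
    where
    k′<i : toℕ (next k) ℕ.< toℕ i
    k′<i = subst (ℕ._< toℕ i) (sym e) 1≤i
    x-k′ : x (next k) ≡ 0ℤ
    x-k′ = ∉ (next k) λ i≤k′ _ → ℕ.<⇒≱ k′<i i≤k′
    δ-k′ : δ i (next k) ≡ 0ℤ
    δ-k′ = δ-≢ {i = i} {next k} λ i≡ → <⇒≢ k′<i (sym i≡)
    ends-last : j ≡ k → (x k - x (next k)) * (x k - x (next k)) ≡ δ j k + δ i (next k)
    ends-last j≡k = conclude (lookup-interval-∈ (subst (i Fin.≤_) j≡k i≤j) (ℕ.≤-reflexive (cong toℕ (sym j≡k)))) x-k′ (δ-≡ j≡k) δ-k′ refl
    ends-before : j ≢ k → (x k - x (next k)) * (x k - x (next k)) ≡ δ j k + δ i (next k)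
    ends-before j≢k = conclude
      (∉ k λ _ k≤j → j≢k (Fin.toℕ-injective (ℕ.≤-antisym (ℕ.≤-pred (subst (toℕ j ℕ.<_) (sym k+1≡n) (Fin.toℕ<n j))) k≤j)))
      x-k′ (δ-≢ j≢k) δ-k′ refl

lookup-shift : (β : Q n) (m : ℤ) (i : Fin n) → lookup (β ⊕ m · c) i ≡ lookup β i + m
lookup-shift β m i = trans (lookup-⊕ β (m · c) i) (cong (λ z → lookup β i + z)
  (trans (lookup-· m c i) (trans (cong (m *_) (lookup-c i)) (ℤ.*-identityʳ m))))

-- Coefficients drop no lower than -1, so adding m·c with m ≥ 1 restores nonnegativity.
Π-≥-1 : {β : Q n} → β ∈ Π → ∀ k → -1ℤ ℤ.≤ lookup β k
Π-≥-1 (inj₁ (i , j , _ , _ , refl)) k = ℤ.≤-trans ℤ.-≤+ (nonneg (interval-pos i j) k)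
Π-≥-1 {β = β} (inj₂ (i , j , _ , _ , e)) k = subst (-1ℤ ℤ.≤_) (ℤ.neg-involutive (lookup β k))
  (ℤ.neg-mono-≤ (ℤ.≤-trans (ℤ.≤-reflexive (trans (sym (lookup-neg β k)) (cong (λ a → lookup a k) e))) (interval-≤1 i j k)))

positiveRealRoot-pos : {γ : Q n} → γ ∈ PositiveRealRoot → Pos γ
positiveRealRoot-pos {γ = γ} (β , m , β∈Π , γ≡ , inj₁ 0<m) = nonnegative λ k → subst (0ℤ ℤ.≤_)
  (sym (trans (cong (λ a → lookup a k) γ≡) (lookup-shift β m k)))
  (ℤ.+-mono-≤ { -1ℤ} {lookup β k} {1ℤ} (Π-≥-1 β∈Π k) (ℤ.i<j⇒suc[i]≤j 0<m))
positiveRealRoot-pos {γ = γ} (β , m , _ , γ≡ , inj₂ (m≡0 , (i , j , _ , _ , β≡))) = nonnegative λ k → subst (0ℤ ℤ.≤_)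
  (sym (trans (cong (λ a → lookup a k) γ≡) (trans (lookup-shift β m k) (trans (cong (λ z → lookup β k + z) m≡0)
    (trans (ℤ.+-identityʳ (lookup β k)) (cong (λ a → lookup a k) β≡))))))
  (nonneg (interval-pos i j) k)

module _ (3≤n : 3 ℕ.≤ n) where

  interval-root : (i j : Fin n) → 1 ℕ.≤ toℕ i → i Fin.≤ j → Root (interval i j)
  interval-root i j 1≤i i≤j = root (trans (norm-squares 3≤n (interval i j)) (trans (sum-cong (interval-jump i j 1≤i i≤j))
    (trans (sum-+ (δ j) (δ i ∘ next)) (cong₂ _+_ (sum-δ-1 j) (trans (sum-next (δ i)) (sum-δ-1 i))))))

  -- By `norm-squares` the norm sees only differences of coefficients, up to sign. This serves both
  -- for -β and for the shift by m·c.
  root-resp-differences : {a b : Q n} →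
    (∀ i j → (lookup a i - lookup a j) * (lookup a i - lookup a j) ≡
             (lookup b i - lookup b j) * (lookup b i - lookup b j)) →
    Root a → Root b
  root-resp-differences {a} {b} eq a-root = root (trans (norm-squares 3≤n b) (trans
    (sum-cong λ i → sym (eq i (next i))) (trans (sym (norm-squares 3≤n a)) (norm≡2 a-root))))

  Π-root : {β : Q n} → β ∈ Π → Root β
  Π-root (inj₁ (i , j , 1≤i , i≤j , refl)) = interval-root i j 1≤i i≤j
  Π-root {β} (inj₂ (i , j , 1≤i , i≤j , e)) = root-resp-differences {neg β} {β}
    (λ k l → trans (cong₂ (λ x y → (x - y) * (x - y)) (lookup-neg β k) (lookup-neg β l)) (ring (lookup β k) (lookup β l)))
    (subst Root (sym e) (interval-root i j 1≤i i≤j))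
    where
    ring : ∀ x y → (- x - - y) * (- x - - y) ≡ (x - y) * (x - y)
    ring = solve-∀

  positiveRealRoot-root : {γ : Q n} → γ ∈ PositiveRealRoot → Root γ
  positiveRealRoot-root {γ} (β , m , β∈Π , γ≡ , _) = subst Root (sym γ≡) (root-resp-differences {β} {β ⊕ m · c}
    (λ k l → sym (trans (cong₂ (λ x y → (x - y) * (x - y)) (lookup-shift β m k) (lookup-shift β m l)) (ring (lookup β k) (lookup β l) m)))
    (Π-root β∈Π))
    where
    ring : ∀ x y m → (x + m - (y + m)) * (x + m - (y + m)) ≡ (x - y) * (x - y)
    ring = solve-∀

-- The Bruhat order

HasLength-resp : {u v : Q n → Q n} {k : ℕ} → u ≗ v → HasLength u k → HasLength v k
HasLength-resp u≗v ((w , eq , len) , min) =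
  (w , (λ μ → trans (sym (u≗v μ)) (eq μ)) , len) , λ w eq → min w λ μ → trans (u≗v μ) (eq μ)

HasLength-unique : {u : Q n → Q n} {k l : ℕ} → HasLength u k → HasLength u l → k ≡ l
HasLength-unique ((w , eq , refl) , min) ((w′ , eq′ , refl) , min′) = ℕ.≤-antisym (min w′ eq′) (min′ w eq)

-- Every `_⟶_` step strictly raises the length; antisymmetry and the minimality of `id` rest on
-- this.
≤ᴮ-length : {u v : Q n → Q n} {l : ℕ} → u ≤ᴮ v → HasLength v l → u ≗ v ⊎ ∃ λ k → HasLength u k × k ℕ.< l
≤ᴮ-length (refl _ u≗v) _ = inj₁ u≗v
≤ᴮ-length (step (_ , k , m , u-length , v-length , k<m) v≤w) w-length with ≤ᴮ-length v≤w w-length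
... | inj₁ v≗w = inj₂ (k , u-length , subst (k ℕ.<_) (HasLength-unique (HasLength-resp v≗w v-length) w-length) k<m)
... | inj₂ (m′ , v-length′ , m′<l) =
  inj₂ (k , u-length , ℕ.<-trans (subst (k ℕ.<_) (HasLength-unique v-length v-length′) k<m) m′<l)

≤ᴮ-respʳ : {u v w : Q n → Q n} → v ≗ w → u ≤ᴮ v → u ≤ᴮ w
≤ᴮ-respʳ v≗w (refl u∈W u≗v)    = refl u∈W λ μ → trans (u≗v μ) (v≗w μ)
≤ᴮ-respʳ v≗w (step u⟶x x≤v) = step u⟶x (≤ᴮ-respʳ v≗w x≤v)

≤ᴮ-antisym : {u v : Q n → Q n} {l : ℕ} → HasLength v l → u ≤ᴮ v → v ≤ᴮ u → u ≗ v
≤ᴮ-antisym v-length u≤v v≤u with ≤ᴮ-length u≤v v-length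
... | inj₁ u≗v = u≗v
... | inj₂ (k , u-length , k<l) with ≤ᴮ-length v≤u u-length
...   | inj₁ v≗u = λ μ → sym (v≗u μ)
...   | inj₂ (l′ , v-length′ , l′<k) = ⊥-elim (ℕ.<-irrefl (HasLength-unique v-length′ v-length) (ℕ.<-trans l′<k k<l))

≤ᴮ-id : {u : Q n → Q n} → u ≤ᴮ id → u ≗ id
≤ᴮ-id u≤id with ≤ᴮ-length u≤id (([] , (λ _ → refl) , refl) , λ _ _ → z≤n)
... | inj₁ u≗id = u≗id

-- From chains of degree at most α up to the reflection in α

length-increase : ∀ {k k′ r x} → + k + + suc r ≡ x → + k′ + + r ≡ x → k ℕ.< k′
length-increase {k} {k′} {r} e e′ = ℕ.≤-reflexive (ℕ.+-cancelʳ-≡ r (suc k) k′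
  (trans (sym (ℕ.+-suc k r)) (ℤ.+-injective (trans e (sym e′)))))

simpleRoot-small : (k : Fin n) → SmallRoot (simpleRoot k)
simpleRoot-small k = record
  { isRoot  = simpleRoot-root k
  ; isPos   = simpleRoot-pos k
  ; bounded = λ i → [ (λ e → subst (ℤ._≤ 1ℤ) (sym e) (ℤ.+≤+ z≤n)) , (λ (_ , e) → ℤ.≤-reflexive e) ]′ (simpleRoot-0/1 k i)
  }

orthogonal-perp : {β : Q n} {L : List (Q n)} → All (Perp β) L → ⟨ β , total L ⟩ ≡ 0ℤ
orthogonal-perp {β = β} [] = ⟨,𝟎⟩ β
orthogonal-perp {β = β} {L = γ ∷ L} (perp e ∷ β⊥L) = trans (⟨⟩-⊕ʳ γ (total L) β) (cong₂ _+_ e (orthogonal-perp β⊥L))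

orthogonal-norm : {L : List (Q n)} → All SmallRoot L → Orthogonal L → ⟨ total L , total L ⟩ ≡ + 2 * + length L
orthogonal-norm {n} [] [] = ⟨𝟎,⟩ (𝟎 {n})
orthogonal-norm {L = β ∷ L} (β-small ∷ roots) (β⊥L ∷ orth) = trans (norm-⊕ β (total L)) (trans
  (cong₂ _+_ (cong₂ (λ x y → x + + 2 * y) (norm≡2 (SmallRoot.isRoot β-small)) (orthogonal-perp β⊥L)) (orthogonal-norm roots orth))
  (ring (+ length L)))
  where
  ring : ∀ x → + 2 + + 2 * 0ℤ + + 2 * x ≡ + 2 * (1ℤ + x)
  ring = solve-∀

⊕-identityʳ : (a : Q n) → a ⊕ 𝟎 ≡ a
⊕-identityʳ = zipWith-identityʳ ℤ.+-identityʳ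

orthogonal-singleton : {α : Q n} {N : List (Q n)} → Root α → All SmallRoot N → Orthogonal N → total N ≡ α → s α ≗ prod N
orthogonal-singleton {α = α} {N = N} α-root roots orth tot =
  go N tot (trans (sym (orthogonal-norm roots orth)) (trans (cong (λ x → ⟨ x , x ⟩) tot) (norm≡2 α-root)))
  where
  go : ∀ N → total N ≡ α → + 2 * + length N ≡ + 2 → s α ≗ prod N
  go [] _ ()
  go (β ∷ []) tot _ μ = cong (λ a → s a μ) (trans (sym tot) (⊕-identityʳ β))
  go (β ∷ γ ∷ N) _ e = ⊥-elim (ℕ.m+1+n≢0 (length N) (ℕ.suc-injective (ℕ.suc-injective (ℤ.+-injective e))))

chain-pos : ∀ {u v} {d : Q n} → Chain u d v → Pos d
chain-pos ([] _ _) = nonnegative λ i → ℤ.≤-reflexive (sym (lookup-𝟎 i))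
chain-pos (_∷_ {α = β} {d} (_ , β∈ , _) chain) = nonnegative λ i → subst (0ℤ ℤ.≤_) (sym (lookup-⊕ β d i))
  (ℤ.+-mono-≤ (nonneg (positiveRealRoot-pos β∈) i) (nonneg (chain-pos chain) i))

module _ (α : Q n) where

  missing : (L : List (Q n)) → Q n
  missing L = α ⊖ total L

  missing-pos : (L : List (Q n)) → total L ≼ α → ∀ i → 0ℤ ℤ.≤ lookup (missing L) i
  missing-pos L tot≼α i = subst (0ℤ ℤ.≤_) (sym (lookup-⊖ α (total L) i)) (ℤ.i≤j⇒0≤j-i (tot≼α i))

  add-simple : (L : List (Q n)) → total L ≼ α → (k : Fin n) → 0ℤ ℤ.< lookup (missing L) k → total (simpleRoot k ∷ L) ≼ α
  add-simple L tot≼α k 0<m i = ℤ.≤-trans (ℤ.≤-reflexive (lookup-⊕ (simpleRoot k) (total L) i))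
    ([ (λ e → ℤ.≤-trans (ℤ.≤-reflexive (trans (cong (_+ lookup (total L) i) e) (ℤ.+-identityˡ (lookup (total L) i)))) (tot≼α i))
     , (λ { (refl , e) → ℤ.≤-trans (ℤ.+-monoˡ-≤ (lookup (total L) i) (ℤ.≤-trans (ℤ.≤-reflexive e)
           (ℤ.≤-trans (ℤ.i<j⇒suc[i]≤j 0<m) (ℤ.≤-reflexive (lookup-⊖ α (total L) i)))))
           (ℤ.≤-reflexive (ring (lookup α i) (lookup (total L) i))) })
     ]′ (simpleRoot-0/1 k i))
    where
    ring : ∀ x y → x - y + y ≡ x
    ring = solve-∀

  ht-missing : (L : List (Q n)) → ht α ≡ ht (missing L) + ht (total L)
  ht-missing L = trans
    (sum-cong λ i → trans (ring (lookup α i) (lookup (total L) i))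
      (cong (_+ lookup (total L) i) (sym (lookup-⊖ α (total L) i))))
    (sum-+ (lookup (missing L)) (lookup (total L)))
    where
    ring : ∀ x y → x ≡ x - y + y
    ring = solve-∀

module _ (3≤n : 3 ℕ.≤ n) where

  ⊑⇒≤ᴮ : {L N : List (Q n)} {u v : Q n → Q n} → Valid L → L ⊑ N → u ≗ prod L → v ≗ prod N → u ≤ᴮ v
  ⊑⇒≤ᴮ {L} valid (same eq _ _) u≗ v≗ =
    refl (Size⇒W (Size-resp (λ μ → sym (u≗ μ)) (proj₁ (proj₂ (list-size 3≤n L valid)))))
         (λ μ → trans (u≗ μ) (trans (eq μ) (sym (v≗ μ))))
  ⊑⇒≤ᴮ {L} {u = u} valid (merge {L′} m roots L′⊑N) u≗ v≗ =
    let (k  , size  , eq)  = list-size 3≤n L valid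
        (k′ , size′ , eq′) = list-size 3≤n L′ valid′
    in step (Size-⟶ 3≤n isReflection (λ μ → trans (prod-∘ μ) (sym (u≗ (t μ)))) (Size-resp (λ μ → sym (u≗ μ)) size) size′
               (length-increase (subst₂ (λ r a → + k + + r ≡ ht a + ht a) length≡ total≡ eq) eq′))
            (⊑⇒≤ᴮ valid′ L′⊑N (λ _ → refl) v≗)
    where
    open Merge m
    valid′ : Valid L′
    valid′ = valid-resp total≡ roots valid

  module _ {α : Q n} (α-small : SmallRoot α) where

    reflection-reachable : α ∈ PositiveRealRoot → ∀ {v} → v ≗ s α → v ∈ Reachable α id
    reflection-reachable α∈ v≗ = id , α ⊕ 𝟎 , refl id∈W (λ _ → refl) ,
      (id∈W , α∈ , v≗) ∷ [] v∈W (λ _ → refl) ,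
      λ i → ℤ.≤-reflexive (cong (λ a → lookup a i) (⊕-identityʳ α))
      where
      id∈W : id ∈ W {n}
      id∈W = [] , λ _ → refl
      v∈W = let (h , ht≡) = ht≡1+ (SmallRoot.isRoot α-small) (SmallRoot.isPos α-small)
            in Size⇒W (Size-resp (λ μ → sym (v≗ μ)) (proj₁ (smallRoot-reduced 3≤n h α-small ht≡)))

    reflection-length : ∃ (HasLength (s α))
    reflection-length = let (h , ht≡) = ht≡1+ (SmallRoot.isRoot α-small) (SmallRoot.isPos α-small)
      in suc (h ℕ.+ h) , Size⇒HasLength 3≤n (proj₁ (smallRoot-reduced 3≤n h α-small ht≡))

  module _ {α : Q n} (α-small : SmallRoot α) (α-gap : ∃ λ i → lookup α i ≡ 0ℤ) where

    valid-below : {L : List (Q n)} → All SmallRoot L → total L ≼ α → Valid L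
    valid-below {L} roots tot≼α = record
      { roots   = roots
      ; total≤1 = λ i → ℤ.≤-trans (tot≼α i) (SmallRoot.bounded α-small i)
      ; gap     = proj₁ α-gap , ℤ.≤-antisym (subst (lookup (total L) (proj₁ α-gap) ℤ.≤_) (proj₂ α-gap) (tot≼α (proj₁ α-gap)))
                                            (nonneg (total-pos roots) (proj₁ α-gap))
      }

    -- m is the number of simple roots still to be inserted; inserting only where α exceeds
    -- `total L` keeps the supports disjoint. Merging waits until m = 0, as counting orthogonal
    -- factors by the norm requires their sum to be exactly α.
    prod-≤ᴮ : ∀ m (L : List (Q n)) → All SmallRoot L → total L ≼ α → ht (missing α L) ≡ + m →
      ∀ {v} → v ≗ prod L → v ≤ᴮ s α
    prod-≤ᴮ zero L roots tot≼α e v≗ =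
      let (N , L⊑N , orth , N-roots) = normalise 3≤n L valid
      in ⊑⇒≤ᴮ valid L⊑N v≗ (orthogonal-singleton (SmallRoot.isRoot α-small) N-roots orth (trans (sym (⊑-total L⊑N)) tot≡α))
      where
      valid = valid-below roots tot≼α
      tot≡α : total L ≡ α
      tot≡α = lookup-inj λ i → sym (ℤ.i-j≡0⇒i≡j (lookup α i) (lookup (total L) i)
        (trans (sym (lookup-⊖ α (total L) i)) (sum-≥0-≡0 (lookup (missing α L)) (missing-pos α L tot≼α) e i)))
    prod-≤ᴮ (suc m) L roots tot≼α e {v} v≗ = insert (sum>0⇒∃>0 (lookup (missing α L)) (subst (0ℤ ℤ.<_) (sym e) (ℤ.+<+ (s≤s z≤n))))
      where
      insert : (∃ λ k → 0ℤ ℤ.< lookup (missing α L) k) → v ≤ᴮ s α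
      insert (k , 0<m) =
        let (l  , size  , eq)  = list-size 3≤n L (valid-below roots tot≼α)
            (l′ , size′ , eq′) = list-size 3≤n L′ (valid-below roots′ tot′≼α)
        in step (Size-⟶ 3≤n (Reflection-simple k) (λ μ → sym (v≗ (s (simpleRoot k) μ)))
                  (Size-resp (λ μ → sym (v≗ μ)) size) size′ (increase eq eq′))
                (prod-≤ᴮ m L′ roots′ tot′≼α missing′ (λ _ → refl))
        where
        L′ : List (Q n)
        L′ = simpleRoot k ∷ L
        roots′ : All SmallRoot L′
        roots′ = simpleRoot-small k ∷ roots
        tot′≼α : total L′ ≼ α
        tot′≼α = add-simple α L tot≼α k 0<m
        ht′ : ht (total L′) ≡ 1ℤ + ht (total L)
        ht′ = trans (ht-⊕ (simpleRoot k) (total L)) (cong (_+ ht (total L)) (ht-simpleRoot k))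
        missing′ : ht (missing α L′) ≡ + m
        missing′ = ℤ-Group.∙-cancelʳ (1ℤ + ht (total L)) (ht (missing α L′)) (+ m)
          (trans (cong (λ z → ht (missing α L′) + z) (sym ht′)) (trans (sym (ht-missing α L′)) (trans (ht-missing α L)
            (trans (cong (_+ ht (total L)) e) (ring (+ m) (ht (total L)))))))
          where
          ring : ∀ m t → 1ℤ + m + t ≡ m + (1ℤ + t)
          ring = solve-∀
        -- Twice the height grows by 2 and the number of factors by 1.
        increase : ∀ {l l′} → + l + + length L ≡ ht (total L) + ht (total L) →
          + l′ + + suc (length L) ≡ ht (total L′) + ht (total L′) → l ℕ.< l′
        increase {l} {l′} eq eq′ = ℕ.≤-reflexive (ℤ.+-injective (ℤ-Group.∙-cancelʳ (+ suc (length L)) (+ suc l) (+ l′)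
          (trans (ring₁ (+ l) (+ length L)) (trans (cong (λ z → + 2 + z) eq) (trans (ring₂ (ht (total L)))
            (trans (sym (cong₂ _+_ ht′ ht′)) (sym eq′)))))))
          where
          ring₁ : ∀ l r → 1ℤ + l + (1ℤ + r) ≡ + 2 + (l + r)
          ring₁ = solve-∀
          ring₂ : ∀ t → + 2 + (t + t) ≡ 1ℤ + t + (1ℤ + t)
          ring₂ = solve-∀

    -- L holds the roots of the edges already followed. Bounding the remaining degree together with
    -- `total L` by α makes the next root small, and at the end of the chain leaves a total below α
    -- for `prod-≤ᴮ`.
    chain-≤ᴮ : ∀ {u v} {d : Q n} → Chain u d v → (L : List (Q n)) → All SmallRoot L → u ≗ prod L → d ⊕ total L ≼ α → v ≤ᴮ s α
    chain-≤ᴮ ([] _ u≗v) L roots u≗ below = prod-≤ᴮ ℤ.∣ ht (missing α L) ∣ L roots tot≼α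
      (sym (ℤ.0≤i⇒+∣i∣≡i (sum-≥0 (lookup (missing α L)) (missing-pos α L tot≼α)))) (λ μ → trans (sym (u≗v μ)) (u≗ μ))
      where
      tot≼α : total L ≼ α
      tot≼α i = ℤ.≤-trans (ℤ.≤-reflexive (sym (trans (lookup-⊕ 𝟎 (total L) i)
        (trans (cong (_+ lookup (total L) i) (lookup-𝟎 i)) (ℤ.+-identityˡ (lookup (total L) i)))))) (below i)
    chain-≤ᴮ (_∷_ {α = β} {d} (_ , β∈ , v≗) chain) L roots u≗ below =
      chain-≤ᴮ chain (β ∷ L) (β-small ∷ roots) (λ μ → trans (v≗ μ) (u≗ (s β μ)))
        (λ i → subst (λ a → lookup a i ℤ.≤ lookup α i) (trans (⊕-assoc β d (total L)) (⊕-swap β d (total L))) (below i))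
      where
      β-small : SmallRoot β
      β-small = record
        { isRoot  = positiveRealRoot-root 3≤n β∈
        ; isPos   = positiveRealRoot-pos β∈
        ; bounded = λ i → ℤ.≤-trans (ℤ.≤-reflexive (ring (lookup β i)))
            (ℤ.≤-trans (ℤ.+-mono-≤ (ℤ.+-monoʳ-≤ (lookup β i) (nonneg (chain-pos chain) i)) (nonneg (total-pos roots) i))
              (ℤ.≤-trans (ℤ.≤-reflexive (sym (trans (lookup-⊕ (β ⊕ d) (total L) i) (cong (_+ lookup (total L) i) (lookup-⊕ β d i)))))
                (ℤ.≤-trans (below i) (SmallRoot.bounded α-small i))))
        }
        where
        ring : ∀ x → x ≡ x + 0ℤ + 0ℤ
        ring = solve-∀

    reachable-≤ᴮ : ∀ {v} → v ∈ Reachable α id → v ≤ᴮ s α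
    reachable-≤ᴮ (u′ , e , u′≤id , chain , e≼α) = chain-≤ᴮ chain [] [] (≤ᴮ-id u′≤id)
      (λ i → subst (λ a → lookup a i ℤ.≤ lookup α i) (sym (⊕-identityʳ e)) (e≼α i))

≺c⇒gap : {α : Q n} → Pos α → α ≺ c → ∃ λ i → lookup α i ≡ 0ℤ
≺c⇒gap {n} {α} α≥0 (α≼c , α≢c) = zero-coordinate (Fin.¬∀⟶∃¬ n _ (λ i → lookup α i ℤ.≟ 1ℤ)
  λ all-1 → α≢c (lookup-inj λ i → trans (all-1 i) (sym (lookup-c i))))
  where
  is-0 : ∀ {x} → 0ℤ ℤ.≤ x → x ℤ.≤ 1ℤ → x ≢ 1ℤ → x ≡ 0ℤ
  is-0 {+ 0} _ _ _ = refl
  is-0 {+ 1} _ _ x≢1 = ⊥-elim (x≢1 refl)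
  is-0 {+ suc (suc k)} _ (ℤ.+≤+ (s≤s ())) _
  zero-coordinate : (∃ λ i → lookup α i ≢ 1ℤ) → ∃ λ i → lookup α i ≡ 0ℤ
  zero-coordinate (i , αᵢ≢1) = i , is-0 (nonneg α≥0 i) (subst (lookup α i ℤ.≤_) (lookup-c i) (α≼c i)) αᵢ≢1

theorem5p3 : (n : ℕ) → 3 ≤ n → (α : Q n) → α ∈ PositiveRealRoot → α ≺ c →
    Γ α id ≐ (_≗ s α)
theorem5p3 n 3≤n α α∈ α≺c = maximal⇒reflection , reflection⇒maximal
  where
  α-small : SmallRoot α
  α-small = record
    { isRoot  = positiveRealRoot-root 3≤n α∈
    ; isPos   = positiveRealRoot-pos α∈
    ; bounded = λ i → subst (lookup α i ℤ.≤_) (lookup-c i) (proj₁ α≺c i)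
    }
  α-gap : ∃ λ i → lookup α i ≡ 0ℤ
  α-gap = ≺c⇒gap (SmallRoot.isPos α-small) α≺c
  below : ∀ {v} → v ∈ Reachable α id → v ≤ᴮ s α
  below = reachable-≤ᴮ 3≤n α-small α-gap
  reachable : ∀ {v} → v ≗ s α → v ∈ Reachable α id
  reachable = reflection-reachable 3≤n α-small α∈
  maximal⇒reflection : ∀ {v} → v ∈ Γ α id → v ≗ s α
  maximal⇒reflection (v-reachable , maximal) μ =
    sym (maximal (s α) (reachable λ _ → refl) (below v-reachable) μ)
  reflection⇒maximal : ∀ {v} → v ≗ s α → v ∈ Γ α id
  reflection⇒maximal {v} v≗ = reachable v≗ , λ w w-reachable v≤w →
    ≤ᴮ-antisym (HasLength-resp sα≗v (proj₂ (reflection-length 3≤n α-small)))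
      (≤ᴮ-respʳ sα≗v (below w-reachable)) v≤w
    where
    sα≗v : s α ≗ v
    sα≗v μ = sym (v≗ μ)
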